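{- Let $m$ be a complex number, $x$ an indeterminate, and let $D_m(n,x)=\sum_{k=0}^n W_m(n,k)x^k$ be the Dowling polynomials. Then, as formal power series in $z$, $$\sum_{n=0}^{\infty}D_m(n,x)z^n=\cfrac{1}{1-b_0z-\cfrac{\lambda_1z^2}{1-b_1z-\cfrac{\lambda_2z^2}{1-b_2z-\cfrac{\lambda_3z^2}{1-b_3z-\cdots}}}},$$ where $b_n=x+nm+1$ for $n\ge 0$ and $\lambda_n=nmx$ for $n\ge 1$. Consequently, the Hankel transform $h_n=\det\big(D_m(i+j,x)\big)_{0\le i,j\le n}$ of the sequence $(D_m(n,x))_{n\ge 0}$ is, for all $n\ge 0$, $$h_n=(mx)^{\binom{n+1}{2}}\prod_{k=0}^n k!.$$
   Context: The Whitney numbers of the second kind of Dowling lattices are $W_m(n,k)=\sum_{i=k}^n\binom{n}{i}m^{i-k}S(i,k)$ (with $0^0=1$), where $S(i,k)$ are the Stirling numbers of the second kind; for $m\ne 0$ this is equivalent to $\sum_{n\ge 0} W_m(n,k)\frac{z^n}{n!}=\frac{e^z}{m^k k!}(e^{mz}-1)^k$, and $W_0(n,k)=\binom{n}{k}$. The infinite continued fraction denotes the limit, in the $z$-adic topology on $\mathbb{C}[x][[z]]$, of its finite truncations. The Hankel transform of a sequence $(a_n)_{n\ge 0}$ is the sequence of determinants $h_n=\det(a_{i+j})_{0\le i,j\le n}$. -}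

module Defs where

open import Algebra.Bundles.Raw using (RawRing)
import Algebra.Definitions.RawSemiring as RawSemiringDefinitions
open import Data.Fin.Base using (Fin; zero; suc; toℕ; punchIn)
open import Data.List.Base as List using (List; []; _∷_)
open import Data.Nat.Base as ℕ using (ℕ; zero; suc; _∸_)
open import Data.Nat.Combinatorics using (_C_)
open import Data.Product.Base using (∃-syntax)
open import Data.Vec.Base as Vec using (Vec)

-- Stirling numbers of the second kind.
S : ℕ → ℕ → ℕ
S zero    zero    = 1
S zero    (suc k) = 0
S (suc n) zero    = 0
S (suc n) (suc k) = suc k ℕ.* S n (suc k) ℕ.+ S n k

module RingNotation {c ℓ} (R : RawRing c ℓ) where
  open RawRing R public
  open RawSemiringDefinitions rawSemiring public
    using (_×_; _^_; sum; product)

  infixl 6 _-_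
  _-_ : Carrier → Carrier → Carrier
  a - b = a + - b

  -- The sum of f i over a ≤ i ≤ b, empty when b < a.
  ∑ : ℕ → ℕ → (ℕ → Carrier) → Carrier
  ∑ a b f = sum {suc b ∸ a} (λ j → f (a ℕ.+ toℕ j))

  infixl 5 ∑
  syntax ∑ a b (λ i → e) = ∑[ a ≤ i ≤ b ] e

-- Polynomials in one indeterminate as coefficient lists, constant term first.
-- Trailing zeros are allowed, so equality is coefficientwise.
module Polynomial {c ℓ} (R : RawRing c ℓ) where
  open RingNotation R

  Poly : Set c
  Poly = List Carrier

  coeff : Poly → ℕ → Carrier
  coeff []      n       = 0#
  coeff (a ∷ p) zero    = a
  coeff (a ∷ p) (suc n) = coeff p n

  infixl 6 _+ₚ_
  _+ₚ_ : Poly → Poly → Poly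
  []      +ₚ q       = q
  (a ∷ p) +ₚ []      = a ∷ p
  (a ∷ p) +ₚ (b ∷ q) = (a + b) ∷ (p +ₚ q)

  infixl 7 _*ₚ_
  _*ₚ_ : Poly → Poly → Poly
  []      *ₚ q = []
  (a ∷ p) *ₚ q = List.map (a *_) q +ₚ (0# ∷ (p *ₚ q))

  const : Carrier → Poly
  const a = a ∷ []

  X : Poly
  X = 0# ∷ 1# ∷ []

  polynomialRing : RawRing c ℓ
  polynomialRing = record
    { Carrier = Poly
    ; _≈_     = λ p q → ∀ n → coeff p n ≈ coeff q n
    ; _+_     = _+ₚ_
    ; _*_     = _*ₚ_
    ; -_      = List.map (-_)
    ; 0#      = []
    ; 1#      = const 1#
    }

module PowerSeries {c ℓ} (R : RawRing c ℓ) where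
  open RingNotation R

  Series : Set c
  Series = ℕ → Carrier

  const : Carrier → Series
  const a zero    = a
  const a (suc n) = 0#

  z : Series
  z zero          = 0#
  z (suc zero)    = 1#
  z (suc (suc n)) = 0#

  seriesRing : RawRing c ℓ
  seriesRing = record
    { Carrier = Series
    ; _≈_     = λ f g → ∀ n → f n ≈ g n
    ; _+_     = λ f g n → f n + g n
    ; _*_     = λ f g n → ∑[ 0 ≤ k ≤ n ] f k * g (n ∸ k)
    ; -_      = λ f n → - f n
    ; 0#      = const 0#
    ; 1#      = const 1#
    }

  -- For f with constant term 1, the coefficients gₙ, …, g₀ (in this order) of
  -- g = 1/f, obtained by solving f g = 1:
  -- g₀ = 1 and gₙ₊₁ = - (f₁ gₙ + f₂ gₙ₋₁ + ⋯ + fₙ₊₁ g₀).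
  recipCoeffs : Series → (n : ℕ) → Vec Carrier (suc n)
  recipCoeffs f zero    = 1# Vec.∷ Vec.[]
  recipCoeffs f (suc n) =
    (- sum (λ i → f (suc (toℕ i)) * Vec.lookup gs i)) Vec.∷ gs
    where
    gs : Vec Carrier (suc n)
    gs = recipCoeffs f n

  -- The reciprocal of f, meaningful only when the constant term of f is 1.
  infix 9 1/_
  1/_ : Series → Series
  (1/ f) n = Vec.head (recipCoeffs f n)

  -- Convergence in the z-adic topology: for every k, all but finitely many
  -- terms are congruent to f modulo z^k.
  infix 4 _⟶_
  _⟶_ : (ℕ → Series) → Series → Set ℓ
  s ⟶ f = ∀ k → ∃[ N ] (∀ n → N ℕ.≤ n → ∀ j → j ℕ.< k → s n j ≈ f j)

module ContinuedFraction {c ℓ} (R : RawRing c ℓ) where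
  open PowerSeries R
  open RingNotation seriesRing

  -- The truncation of
  --   1/(1 - bᵢ z - λᵢ₊₁ z² /(1 - bᵢ₊₁ z - λᵢ₊₂ z² /(1 - bᵢ₊₂ z - ⋯)))
  -- whose last denominator is 1 - bᵢ₊ₙ z.  All denominators have constant
  -- term 1.
  truncationFrom : (b lam : ℕ → RawRing.Carrier R) → ℕ → ℕ → Series
  truncationFrom b lam i zero    = 1/ (1# - const (b i) * z)
  truncationFrom b lam i (suc n) =
    1/ (1# - const (b i) * z
           - const (lam (suc i)) * z ^ 2 * truncationFrom b lam (suc i) n)

  truncation : (b lam : ℕ → RawRing.Carrier R) → ℕ → Series
  truncation b lam = truncationFrom b lam 0

module Determinant {c ℓ} (R : RawRing c ℓ) where
  open RingNotation R

  Matrix : ℕ → Set c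
  Matrix n = Fin n → Fin n → Carrier

  minor : ∀ {n} → Fin (suc n) → Matrix (suc n) → Matrix n
  minor j A i k = A (suc i) (punchIn j k)

  -- Laplace expansion along the first row.
  det : ∀ {n} → Matrix n → Carrier
  det {zero}  A = 1#
  det {suc n} A = sum (λ j → (- 1#) ^ toℕ j * A zero j * det (minor j A))

  hankelTransform : (ℕ → Carrier) → ℕ → Carrier
  hankelTransform a n = det {suc n} (λ i j → a (toℕ i ℕ.+ toℕ j))

module Dowling {c ℓ} (K : RawRing c ℓ) (m : RawRing.Carrier K) where
  open Polynomial K using (Poly; polynomialRing; const; X)

  W : ℕ → ℕ → RawRing.Carrier K
  W n k = ∑[ k ≤ i ≤ n ] (n C i) × (m ^ (i ∸ k) * (S i k × 1#))
    where open RingNotation K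

  D : ℕ → Poly
  D n = ∑[ 0 ≤ k ≤ n ] const (W n k) * X ^ k
    where open RingNotation polynomialRing

{-# OPTIONS --safe #-}

-- Let a(n,k) be the k-th Hasse derivative of D n with respect to x.  The recurrence
-- W(n+1,k) = W(n,k-1) + (1 + k m) W(n,k) turns into
--   a(n+1,k) = a(n,k-1) + b k a(n,k) + λ(k+1) a(n,k+1).
-- For any array with this recurrence, the column series C k = Σ a(n,k) zⁿ satisfy
--   C k = z C (k-1) + z (b k C k + λ(k+1) C (k+1)),
-- with 1 in place of z C (k-1) for k = 0, so that C k = T z C (k-1) modulo zⁿ for the n-th
-- truncation T of the continued fraction that starts at level k, by induction on n.
-- Moreover Σₖ a(i,k) λ 1 ⋯ λ k a(j,k) depends on i + j only.  This is an LU factorisation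
-- of the Hankel matrix, with unit upper triangular second factor.
module Submission where

open import Algebra.Bundles using (CommutativeMonoid; CommutativeRing)
open import Algebra.Bundles.Raw using (RawRing)
import Algebra.Morphism.RingMonomorphism as RingMonomorphism
open import Algebra.Morphism.Structures using (IsRingMonomorphism)
import Algebra.Properties.CommutativeMonoid.Sum
import Algebra.Properties.CommutativeSemigroup
import Algebra.Properties.Ring
import Algebra.Properties.Semiring.Exp
import Algebra.Properties.Semiring.Mult
import Algebra.Properties.Semiring.Sum
import Algebra.Solver.Ring.NaturalCoefficients.Default
open import Data.Empty using (⊥-elim)
open import Data.Fin.Base using (Fin; zero; suc; toℕ; fromℕ<; inject₁; punchIn; punchOut)
open import Data.Fin.Properties
  using (_≟_; toℕ<n; toℕ-inject₁; toℕ-injective; toℕ-fromℕ<; suc-injective;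
         punchIn-injective; punchInᵢ≢i; punchIn-punchOut)
open import Data.List.Base as List using ([]; _∷_)
open import Data.Nat.Base as ℕ using (ℕ; zero; suc; _∸_; z≤n; s≤s; _!)
open import Data.Nat.Combinatorics using (_C_; nC1≡n; nCk+nC[k+1]≡[n+1]C[k+1]; k>n⇒nCk≡0)
import Data.Nat.Properties as ℕ
open import Data.Product.Base using (_,_; proj₁; proj₂; ∃-syntax) renaming (_×_ to _and_)
open import Data.Sum.Base using (_⊎_; inj₁; inj₂)
import Data.Vec.Base as Vec
open import Data.Vec.Functional using (Vector; updateAt)
open import Data.Vec.Functional.Properties using (updateAt-updates; updateAt-minimal)
open import Function.Base using (_∘_; id)
open import Relation.Binary.PropositionalEquality.Core as ≡ using (_≡_; _≢_)
import Relation.Binary.Reasoning.Setoid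
open import Relation.Nullary using (yes; no)
open import Defs

-- The constants have their origin in D(n+1) = (x + 1) D(n) + m x D(n)′. By the Leibniz rule its
-- k-th Hasse derivative carries the factor x + k m + 1 on a(n,k) and (k+1) m x on a(n,k+1). The
-- division by k! built into Hasse derivatives makes the diagonal a(n,n) equal to 1; ordinary
-- derivatives would put n! there, and factorials cannot be cancelled in an arbitrary commutative
-- ring. The same holds for λ, which vanishes for m = 0: the products λ 1 ⋯ λ k are attached to one
-- triangular factor and never inverted. Weighted Motzkin paths explain the factorisation: a(n,k) is
-- the total weight of the n-step paths from height 0 to height k, and the k-th summand collects the
-- closed paths of length i + j that are at height k after i steps. The determinant is given by
-- expansion along the first row. Multiplicativity is avoided: the LU product is evaluated by
-- clearing columns, which needs only linearity in a column and vanishing on equal columns.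

-- The ring of formal power series

module SeriesProperties {c ℓ} (R : CommutativeRing c ℓ) where
  open CommutativeRing R hiding (zero)
  open Algebra.Properties.CommutativeSemigroup +-commutativeSemigroup
    using (interchange)
  open Algebra.Properties.Semiring.Sum semiring using (sum; sum-cong-≋)
  open Relation.Binary.Reasoning.Setoid setoid
  open PowerSeries rawRing
  open RawRing seriesRing using () renaming (_*_ to _⊛_)

  -- The coefficient of index n involves both factors only up to index n. The bounded form allows
  -- series that agree only modulo a power of z to be exchanged inside a product. The induction
  -- works because the product at `suc n` unfolds by computation to `f 0 * h (suc n)` plus the
  -- product of the tail of `f` with `h` at `n`.
  ⊛-cong-≤ : ∀ f g h k n → (∀ j → j ℕ.≤ n → f j ≈ g j) → (∀ j → j ℕ.≤ n → h j ≈ k j) →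
             (f ⊛ h) n ≈ (g ⊛ k) n
  ⊛-cong-≤ f g h k zero    f≈g h≈k = +-congʳ (*-cong (f≈g 0 z≤n) (h≈k 0 z≤n))
  ⊛-cong-≤ f g h k (suc n) f≈g h≈k =
    +-cong (*-cong (f≈g 0 z≤n) (h≈k (suc n) (s≤s ℕ.≤-refl)))
           (⊛-cong-≤ (f ∘ suc) (g ∘ suc) h k n (λ j j≤n → f≈g (suc j) (s≤s j≤n)) (λ j j≤n → h≈k j (ℕ.m≤n⇒m≤1+n j≤n)))

  -- Stated for the function that is `0#` everywhere rather than for `const 0#`: the tail of
  -- `const a` and the coefficients of the empty polynomial compute to this form.
  ⊛-zeroˡ : ∀ f n → ((λ _ → 0#) ⊛ f) n ≈ 0#
  ⊛-zeroˡ f zero    = trans (+-identityʳ _) (zeroˡ _)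
  ⊛-zeroˡ f (suc n) = trans (+-cong (zeroˡ _) (⊛-zeroˡ f n)) (+-identityˡ 0#)

  ⊛-distribʳ : ∀ f g h n → ((λ i → g i + h i) ⊛ f) n ≈ (g ⊛ f) n + (h ⊛ f) n
  ⊛-distribʳ f g h zero    = begin
    (g 0 + h 0) * f 0 + 0#              ≈⟨ +-cong (distribʳ _ _ _) (sym (+-identityʳ 0#)) ⟩
    g 0 * f 0 + h 0 * f 0 + (0# + 0#)   ≈⟨ interchange _ _ _ _ ⟩
    g 0 * f 0 + 0# + (h 0 * f 0 + 0#)   ∎
  ⊛-distribʳ f g h (suc n) = begin
    (g 0 + h 0) * f (suc n) + ((λ i → g (suc i) + h (suc i)) ⊛ f) n
      ≈⟨ +-cong (distribʳ _ _ _) (⊛-distribʳ f (g ∘ suc) (h ∘ suc) n) ⟩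
    g 0 * f (suc n) + h 0 * f (suc n) + (((g ∘ suc) ⊛ f) n + ((h ∘ suc) ⊛ f) n)
      ≈⟨ interchange _ _ _ _ ⟩
    (g ⊛ f) (suc n) + (h ⊛ f) (suc n) ∎

  ⊛-scaleˡ : ∀ a f g n → ((λ i → a * f i) ⊛ g) n ≈ a * (f ⊛ g) n
  ⊛-scaleˡ a f g zero    = begin
    a * f 0 * g 0 + 0#    ≈⟨ +-identityʳ _ ⟩
    a * f 0 * g 0         ≈⟨ *-assoc _ _ _ ⟩
    a * (f 0 * g 0)       ≈⟨ *-congˡ (+-identityʳ _) ⟨
    a * (f 0 * g 0 + 0#)  ∎
  ⊛-scaleˡ a f g (suc n) = begin
    a * f 0 * g (suc n) + ((λ i → a * f (suc i)) ⊛ g) n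
      ≈⟨ +-cong (*-assoc _ _ _) (⊛-scaleˡ a (f ∘ suc) g n) ⟩
    a * (f 0 * g (suc n)) + a * ((f ∘ suc) ⊛ g) n
      ≈⟨ distribˡ _ _ _ ⟨
    a * (f ⊛ g) (suc n) ∎

  ⊛-assoc : ∀ f g h n → ((f ⊛ g) ⊛ h) n ≈ (f ⊛ (g ⊛ h)) n
  ⊛-assoc f g h zero    = begin
    (f 0 * g 0 + 0#) * h 0 + 0#  ≈⟨ +-congʳ (*-congʳ (+-identityʳ _)) ⟩
    f 0 * g 0 * h 0 + 0#         ≈⟨ +-congʳ (*-assoc _ _ _) ⟩
    f 0 * (g 0 * h 0) + 0#       ≈⟨ +-congʳ (*-congˡ (+-identityʳ _)) ⟨
    f 0 * (g 0 * h 0 + 0#) + 0#  ∎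
  ⊛-assoc f g h (suc n) = begin
    (f 0 * g 0 + 0#) * h (suc n) + ((λ i → f 0 * g (suc i) + (f′ ⊛ g) i) ⊛ h) n
      ≈⟨ +-cong (*-congʳ (+-identityʳ _)) (⊛-distribʳ h (λ i → f 0 * g (suc i)) (f′ ⊛ g) n) ⟩
    f 0 * g 0 * h (suc n) + (((λ i → f 0 * g (suc i)) ⊛ h) n + ((f′ ⊛ g) ⊛ h) n)
      ≈⟨ +-cong (*-assoc _ _ _) (+-cong (⊛-scaleˡ (f 0) (g ∘ suc) h n) (⊛-assoc f′ g h n)) ⟩
    f 0 * (g 0 * h (suc n)) + (f 0 * ((g ∘ suc) ⊛ h) n + (f′ ⊛ (g ⊛ h)) n)
      ≈⟨ +-assoc _ _ _ ⟨
    f 0 * (g 0 * h (suc n)) + f 0 * ((g ∘ suc) ⊛ h) n + (f′ ⊛ (g ⊛ h)) n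
      ≈⟨ +-congʳ (distribˡ _ _ _) ⟨
    (f ⊛ (g ⊛ h)) (suc n) ∎
    where f′ = f ∘ suc

  -- Mirror image of the unfolding by computation, which always removes the head of the left factor.
  -- Commutativity needs the head of the right factor removed as well.
  ⊛-splitʳ : ∀ f g n → (f ⊛ g) (suc n) ≈ (f ⊛ (g ∘ suc)) n + f (suc n) * g 0
  ⊛-splitʳ f g zero    = begin
    f 0 * g 1 + (f 1 * g 0 + 0#)  ≈⟨ +-cong (sym (+-identityʳ _)) (+-identityʳ _) ⟩
    f 0 * g 1 + 0# + f 1 * g 0    ∎
  ⊛-splitʳ f g (suc n) = trans (+-congˡ (⊛-splitʳ (f ∘ suc) g n)) (sym (+-assoc _ _ _))

  ⊛-comm : ∀ f g n → (f ⊛ g) n ≈ (g ⊛ f) n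
  ⊛-comm f g zero    = +-congʳ (*-comm _ _)
  ⊛-comm f g (suc n) = begin
    f 0 * g (suc n) + ((f ∘ suc) ⊛ g) n  ≈⟨ +-cong (*-comm _ _) (⊛-comm (f ∘ suc) g n) ⟩
    g (suc n) * f 0 + (g ⊛ (f ∘ suc)) n  ≈⟨ +-comm _ _ ⟩
    (g ⊛ (f ∘ suc)) n + g (suc n) * f 0  ≈⟨ ⊛-splitʳ g f n ⟨
    (g ⊛ f) (suc n)                      ∎

  const⊛ : ∀ a f n → (const a ⊛ f) n ≈ a * f n
  const⊛ a f zero    = +-identityʳ _
  const⊛ a f (suc n) = trans (+-congˡ (⊛-zeroˡ f n)) (+-identityʳ _)

  const0≈0 : ∀ n → const 0# n ≈ 0#
  const0≈0 zero    = refl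
  const0≈0 (suc n) = refl

  seriesCommutativeRing : CommutativeRing c ℓ
  seriesCommutativeRing = record
    { RawRing seriesRing
    ; isCommutativeRing = record
      { isRing = record
        { +-isAbelianGroup = record
          { isGroup = record
            { isMonoid = record
              { isSemigroup = record
                { isMagma = record
                  { isEquivalence = record
                    { refl  = λ n → refl
                    ; sym   = λ f≈g n → sym (f≈g n)
                    ; trans = λ f≈g g≈h n → trans (f≈g n) (g≈h n)
                    }
                  ; ∙-cong = λ f≈g h≈k n → +-cong (f≈g n) (h≈k n)
                  }
                ; assoc = λ f g h n → +-assoc _ _ _
                }
              ; identity = (λ f n → trans (+-congʳ (const0≈0 n)) (+-identityˡ _))
                         , (λ f n → trans (+-congˡ (const0≈0 n)) (+-identityʳ _))
              }
            ; inverse = (λ f n → trans (-‿inverseˡ _) (sym (const0≈0 n)))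
                      , (λ f n → trans (-‿inverseʳ _) (sym (const0≈0 n)))
            ; ⁻¹-cong = λ f≈g n → -‿cong (f≈g n)
            }
          ; comm = λ f g n → +-comm _ _
          }
        ; *-cong = λ {f} {g} {h} {k} f≈g h≈k n → ⊛-cong-≤ f g h k n (λ j _ → f≈g j) (λ j _ → h≈k j)
        ; *-assoc = ⊛-assoc
        ; *-identity = identityˡ , λ f n → trans (⊛-comm f (const 1#) n) (identityˡ f n)
        ; distrib = (λ f g h n → trans (⊛-comm f (λ i → g i + h i) n)
                      (trans (⊛-distribʳ f g h n) (+-cong (⊛-comm g f n) (⊛-comm h f n))))
                  , ⊛-distribʳ
        }
      ; *-comm = ⊛-comm
      }
    }
    where
    identityˡ : ∀ f n → (const 1# ⊛ f) n ≈ f n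
    identityˡ f n = trans (const⊛ 1# f n) (*-identityˡ _)

  -- The newest coefficient is stored first, so position i holds index n ∸ i, which is the reversed
  -- index of a convolution.
  lookup-recipCoeffs : ∀ f n i → Vec.lookup (recipCoeffs f n) i ≡ (1/ f) (n ∸ toℕ i)
  lookup-recipCoeffs f n       zero    = head n
    where
    head : ∀ n → Vec.lookup (recipCoeffs f n) zero ≡ (1/ f) n
    head zero    = ≡.refl
    head (suc n) = ≡.refl
  lookup-recipCoeffs f (suc n) (suc i) = lookup-recipCoeffs f n i

  1/-inverseʳ : ∀ f → f 0 ≈ 1# → ∀ n → (f ⊛ 1/ f) n ≈ const 1# n
  1/-inverseʳ f f₀≈1 zero    = trans (+-identityʳ _) (trans (*-identityʳ _) f₀≈1)
  1/-inverseʳ f f₀≈1 (suc n) = begin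
    -- The new coefficient of `1/ f` is `- Σ` by definition, and `Σ` is the remaining part of the
    -- convolution, so the two cancel.
    f 0 * - Σ + ((f ∘ suc) ⊛ 1/ f) n  ≈⟨ +-cong (trans (*-congʳ f₀≈1) (*-identityˡ _)) (sym (sum-cong-≋ Σ≈)) ⟩
    - Σ + Σ                           ≈⟨ -‿inverseˡ Σ ⟩
    0#                                ∎
    where
    Σ = sum (λ i → f (suc (toℕ i)) * Vec.lookup (recipCoeffs f n) i)
    Σ≈ : ∀ i → f (suc (toℕ i)) * Vec.lookup (recipCoeffs f n) i ≈ f (suc (toℕ i)) * (1/ f) (n ∸ toℕ i)
    Σ≈ i = *-congˡ (reflexive (lookup-recipCoeffs f n i))

-- The ring of polynomials, embedded in the series

module PolynomialProperties {c ℓ} (R : CommutativeRing c ℓ) where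
  open CommutativeRing R hiding (zero)
  open Algebra.Properties.Ring ring using (-0#≈0#)
  open Polynomial rawRing
  open PowerSeries rawRing using (seriesRing)
  open SeriesProperties R
  open RawRing seriesRing using () renaming (_*_ to _⊛_)

  coeff-+ : ∀ p q n → coeff (p +ₚ q) n ≈ coeff p n + coeff q n
  coeff-+ []      q       n       = sym (+-identityˡ _)
  coeff-+ (a ∷ p) []      n       = sym (+-identityʳ _)
  coeff-+ (a ∷ p) (b ∷ q) zero    = refl
  coeff-+ (a ∷ p) (b ∷ q) (suc n) = coeff-+ p q n

  coeff-scale : ∀ a p n → coeff (List.map (a *_) p) n ≈ a * coeff p n
  coeff-scale a []      n       = sym (zeroʳ a)
  coeff-scale a (b ∷ p) zero    = refl
  coeff-scale a (b ∷ p) (suc n) = coeff-scale a p n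

  coeff-neg : ∀ p n → coeff (List.map -_ p) n ≈ - coeff p n
  coeff-neg []      n       = sym -0#≈0#
  coeff-neg (a ∷ p) zero    = refl
  coeff-neg (a ∷ p) (suc n) = coeff-neg p n

  coeff-* : ∀ p q n → coeff (p *ₚ q) n ≈ (coeff p ⊛ coeff q) n
  coeff-* []      q n       = sym (⊛-zeroˡ (coeff q) n)
  coeff-* (a ∷ p) q zero    = trans (coeff-+ (List.map (a *_) q) _ 0) (+-congʳ (coeff-scale a q 0))
  coeff-* (a ∷ p) q (suc n) =
    trans (coeff-+ (List.map (a *_) q) _ (suc n)) (+-cong (coeff-scale a q (suc n)) (coeff-* p q n))

  -- All ring laws for coefficient lists are pulled back from the series along `coeff`. Equality of
  -- polynomials is defined coefficientwise, so injectivity is the identity.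
  coeff-isRingMonomorphism : IsRingMonomorphism polynomialRing seriesRing coeff
  coeff-isRingMonomorphism = record
    { isRingHomomorphism = record
      { isSemiringHomomorphism = record
        { isNearSemiringHomomorphism = record
          { +-isMonoidHomomorphism = record
            { isMagmaHomomorphism = record
              { isRelHomomorphism = record { cong = id }
              ; homo = coeff-+
              }
            ; ε-homo = λ n → sym (const0≈0 n)
            }
          ; *-homo = coeff-*
          }
        ; 1#-homo = λ { zero → refl ; (suc n) → refl }
        }
      ; -‿homo = coeff-neg
      }
    ; injective = id
    }

  polynomialCommutativeRing : CommutativeRing c ℓ
  polynomialCommutativeRing = record
    { RawRing polynomialRing
    ; isCommutativeRing = RingMonomorphism.isCommutativeRing coeff-isRingMonomorphism
        (CommutativeRing.isCommutativeRing seriesCommutativeRing)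
    }

  const-* : ∀ a b n → coeff (const (a * b)) n ≈ coeff (const a *ₚ const b) n
  const-* a b zero    = sym (+-identityʳ _)
  const-* a b (suc n) = refl

  const-0 : ∀ n → coeff (const 0#) n ≈ 0#
  const-0 zero    = refl
  const-0 (suc n) = refl

-- Index shifts and finite sums

-- `prepend 0# f` is the shift k ↦ f (k - 1) with the convention f (-1) = 0; it stands for the term
-- of index k - 1 in the recurrences.
prepend : ∀ {a} {A : Set a} → A → (ℕ → A) → ℕ → A
prepend a f zero    = a
prepend a f (suc k) = f k

module MonoidSum {c ℓ} (M : CommutativeMonoid c ℓ) where
  open CommutativeMonoid M renaming (_∙_ to _+_; ε to 0#; ∙-congˡ to +-congˡ)
  open Algebra.Properties.CommutativeMonoid.Sum M using (sum; sum-cong-≋; sum-replicate-zero)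

  sum-identity : ∀ {n} (t : Vector Carrier n) → (∀ j → t j ≈ 0#) → sum t ≈ 0#
  sum-identity {n} t t≈0 = trans (sum-cong-≋ t≈0) (sum-replicate-zero n)

  sum-last : ∀ n (f : ℕ → Carrier) → sum {suc n} (f ∘ toℕ) ≈ sum {n} (f ∘ toℕ) + f n
  sum-last zero    f = comm _ _
  sum-last (suc n) f = trans (+-congˡ (sum-last n (f ∘ suc))) (sym (assoc _ _ _))

-- Adjacent columns in minors, and adjacent transpositions

-- Deleting column p or column p + 1 leaves the same columns except at one position, where each
-- deletion exposes the column that the other removes. This compares the two minors.
punchIn-adjacent : ∀ {n} (p : Fin n) k →
                   punchIn (inject₁ p) k ≡ punchIn (suc p) k ⊎
                   (punchIn (inject₁ p) k ≡ suc p and punchIn (suc p) k ≡ inject₁ p)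
punchIn-adjacent zero    zero    = inj₂ (≡.refl , ≡.refl)
punchIn-adjacent zero    (suc k) = inj₁ ≡.refl
punchIn-adjacent (suc p) zero    = inj₁ ≡.refl
punchIn-adjacent (suc p) (suc k) with punchIn-adjacent p k
... | inj₁ eq          = inj₁ (≡.cong suc eq)
... | inj₂ (eq₁ , eq₂) = inj₂ (≡.cong suc eq₁ , ≡.cong suc eq₂)

-- Two adjacent columns different from the deleted column j stay adjacent in the minor, which is
-- what makes induction over minors possible.
adjacent-preimage : ∀ {n} (j : Fin (suc (suc n))) (p : Fin (suc n)) → j ≢ inject₁ p → j ≢ suc p →
                    ∃[ p′ ] (punchIn j (inject₁ p′) ≡ inject₁ p and punchIn j (suc p′) ≡ suc p)
adjacent-preimage zero          zero    j≢p j≢sp = ⊥-elim (j≢p ≡.refl)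
adjacent-preimage zero          (suc p) j≢p j≢sp = p , ≡.refl , ≡.refl
adjacent-preimage (suc zero)    zero    j≢p j≢sp = ⊥-elim (j≢sp ≡.refl)
adjacent-preimage {suc n} (suc (suc j)) zero    j≢p j≢sp = zero , ≡.refl , ≡.refl
adjacent-preimage {suc n} (suc j)       (suc p) j≢p j≢sp
  with adjacent-preimage j p (j≢p ∘ ≡.cong suc) (j≢sp ∘ ≡.cong suc)
... | p′ , eq₁ , eq₂ = suc p′ , ≡.cong suc eq₁ , ≡.cong suc eq₂

swapAt : ∀ {n} → Fin n → Fin (suc n) → Fin (suc n)
swapAt zero    zero          = suc zero
swapAt zero    (suc zero)    = zero
swapAt zero    (suc (suc j)) = suc (suc j)
swapAt (suc p) zero          = zero
swapAt (suc p) (suc j)       = suc (swapAt p j)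

swapAt-inject₁ : ∀ {n} (p : Fin n) → swapAt p (inject₁ p) ≡ suc p
swapAt-inject₁ zero    = ≡.refl
swapAt-inject₁ (suc p) = ≡.cong suc (swapAt-inject₁ p)

swapAt-suc : ∀ {n} (p : Fin n) → swapAt p (suc p) ≡ inject₁ p
swapAt-suc zero    = ≡.refl
swapAt-suc (suc p) = ≡.cong suc (swapAt-suc p)

swapAt-other : ∀ {n} (p : Fin n) j → j ≢ inject₁ p → j ≢ suc p → swapAt p j ≡ j
swapAt-other zero    zero          j≢p j≢sp = ⊥-elim (j≢p ≡.refl)
swapAt-other zero    (suc zero)    j≢p j≢sp = ⊥-elim (j≢sp ≡.refl)
swapAt-other zero    (suc (suc j)) j≢p j≢sp = ≡.refl
swapAt-other (suc p) zero          j≢p j≢sp = ≡.refl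
swapAt-other (suc p) (suc j)       j≢p j≢sp =
  ≡.cong suc (swapAt-other p j (j≢p ∘ ≡.cong suc) (j≢sp ∘ ≡.cong suc))

-- Determinants as alternating multilinear functions of the columns

module DeterminantProperties {c ℓ} (R : CommutativeRing c ℓ) where
  open CommutativeRing R hiding (zero)
  open Algebra.Properties.Ring ring using (-1*x≈-x)
  open Algebra.Properties.Semiring.Sum semiring using (sum; sum-cong-≋; ∑-distrib-+; *-distribˡ-sum)
  open Algebra.Solver.Ring.NaturalCoefficients.Default commutativeSemiring
    using (solve; _:+_; _:*_; _:=_)
  open MonoidSum +-commutativeMonoid using (sum-identity)
  open Relation.Binary.Reasoning.Setoid setoid
  open RingNotation rawRing using (_^_; product)
  open Determinant rawRing

  private variable
    n : ℕ

  sum-adjacent-cancel : (t : Vector Carrier (suc n)) (p : Fin n) →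
                        (∀ j → j ≢ inject₁ p → j ≢ suc p → t j ≈ 0#) →
                        t (inject₁ p) + t (suc p) ≈ 0# → sum t ≈ 0#
  sum-adjacent-cancel t zero    t≈0 cancel = begin
    t zero + (t (suc zero) + sum t₂)  ≈⟨ +-assoc _ _ _ ⟨
    t zero + t (suc zero) + sum t₂    ≈⟨ +-cong cancel (sum-identity t₂ (λ j → t≈0 (suc (suc j)) (λ ()) (λ ()))) ⟩
    0# + 0#                           ≈⟨ +-identityˡ 0# ⟩
    0#                                ∎
    where t₂ = λ j → t (suc (suc j))
  sum-adjacent-cancel t (suc p) t≈0 cancel =
    trans (+-cong (t≈0 zero (λ ()) (λ ()))
                  (sum-adjacent-cancel (t ∘ suc) p
                    (λ j j≢p j≢sp → t≈0 (suc j) (j≢p ∘ suc-injective) (j≢sp ∘ suc-injective)) cancel))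
          (+-identityˡ 0#)

  det-cong : ∀ {A B : Matrix n} → (∀ i j → A i j ≈ B i j) → det A ≈ det B
  det-cong {zero}  A≈B = refl
  det-cong {suc n} A≈B = sum-cong-≋ λ j →
    *-cong (*-congˡ {(- 1#) ^ toℕ j} (A≈B zero j)) (det-cong (λ i k → A≈B (suc i) (punchIn j k)))

  hankelTransform-cong : ∀ f g → (∀ i → f i ≈ g i) → ∀ n → hankelTransform f n ≈ hankelTransform g n
  hankelTransform-cong f g f≈g n =
    det-cong {suc n} {λ i j → f (toℕ i ℕ.+ toℕ j)} {λ i j → g (toℕ i ℕ.+ toℕ j)} λ i j → f≈g (toℕ i ℕ.+ toℕ j)

  laplaceTerm : Matrix (suc n) → Fin (suc n) → Carrier
  laplaceTerm A j = (- 1#) ^ toℕ j * A zero j * det (minor j A)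

  -- In the Laplace term at p the linearity sits in the first-row entry, since the minor omits
  -- column p; in every other term it sits in the minor, where column p survives at `punchOut j≢p`
  -- and induction applies.
  det-linear : ∀ (A B V : Matrix n) p c →
               (∀ i j → j ≢ p → A i j ≈ B i j) → (∀ i j → j ≢ p → A i j ≈ V i j) →
               (∀ i → A i p ≈ B i p + c * V i p) → det A ≈ det B + c * det V
  det-linear {suc n} A B V p c A≈B A≈V Aₚ≈ = begin
    det A
      ≈⟨ sum-cong-≋ term ⟩
    sum (λ j → laplaceTerm B j + c * laplaceTerm V j)
      ≈⟨ ∑-distrib-+ (laplaceTerm B) (λ j → c * laplaceTerm V j) ⟩
    det B + sum (λ j → c * laplaceTerm V j)
      ≈⟨ +-congˡ (*-distribˡ-sum c (laplaceTerm V)) ⟨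
    det B + c * det V ∎
    where
    term : ∀ j → laplaceTerm A j ≈ laplaceTerm B j + c * laplaceTerm V j
    term j with j ≟ p
    ... | yes ≡.refl = begin
      s * A zero p * det (minor p A)
        ≈⟨ *-congʳ (*-congˡ (Aₚ≈ zero)) ⟩
      s * (B zero p + c * V zero p) * det (minor p A)
        ≈⟨ solve 5 (λ s b c c₀ d → s :* (b :+ c :* c₀) :* d := s :* b :* d :+ c :* (s :* c₀ :* d)) refl s _ c _ _ ⟩
      s * B zero p * det (minor p A) + c * (s * V zero p * det (minor p A))
        ≈⟨ +-cong (*-congˡ (det-cong (λ i k → A≈B (suc i) _ (punchInᵢ≢i p k))))
                  (*-congˡ (*-congˡ (det-cong (λ i k → A≈V (suc i) _ (punchInᵢ≢i p k))))) ⟩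
      laplaceTerm B p + c * laplaceTerm V p ∎
      where s = (- 1#) ^ toℕ p
    ... | no j≢p = begin
      s * A zero j * det (minor j A)
        ≈⟨ *-congˡ (det-linear (minor j A) (minor j B) (minor j V) p′ c
             (λ i k k≢p′ → A≈B (suc i) _ (≢p k k≢p′)) (λ i k k≢p′ → A≈V (suc i) _ (≢p k k≢p′))
             (λ i → ≡.subst (λ q → A (suc i) q ≈ B (suc i) q + c * V (suc i) q)
                            (≡.sym (punchIn-punchOut j≢p)) (Aₚ≈ (suc i)))) ⟩
      s * A zero j * (det (minor j B) + c * det (minor j V))
        ≈⟨ solve 5 (λ s a c b d → s :* a :* (b :+ c :* d) := s :* a :* b :+ c :* (s :* a :* d)) refl s _ c _ _ ⟩
      s * A zero j * det (minor j B) + c * (s * A zero j * det (minor j V))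
        ≈⟨ +-cong (*-congʳ (*-congˡ (A≈B zero j j≢p))) (*-congˡ (*-congʳ (*-congˡ (A≈V zero j j≢p)))) ⟩
      laplaceTerm B j + c * laplaceTerm V j ∎
      where
      s = (- 1#) ^ toℕ j
      p′ = punchOut j≢p
      ≢p : ∀ k → k ≢ p′ → punchIn j k ≢ p
      ≢p k k≢p′ eq = k≢p′ (punchIn-injective j k p′ (≡.trans eq (≡.sym (punchIn-punchOut j≢p))))

  opposite-signs : ∀ (p : Fin n) {a b d e} → a ≈ b → d ≈ e →
                   (- 1#) ^ toℕ (inject₁ p) * a * d + (- 1#) ^ toℕ (suc p) * b * e ≈ 0#
  opposite-signs p {a} {b} {d} {e} a≈b d≈e = begin
    (- 1#) ^ toℕ (inject₁ p) * a * d + - 1# * s * b * e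
      ≈⟨ +-congʳ (*-cong (*-cong (reflexive (≡.cong ((- 1#) ^_) (toℕ-inject₁ p))) a≈b) d≈e) ⟩
    s * b * e + - 1# * s * b * e
      ≈⟨ +-congˡ (trans (*-congʳ (*-assoc _ _ _)) (*-assoc _ _ _)) ⟩
    s * b * e + - 1# * (s * b * e)
      ≈⟨ +-congˡ (-1*x≈-x _) ⟩
    s * b * e + - (s * b * e)
      ≈⟨ -‿inverseʳ _ ⟩
    0# ∎
    where s = (- 1#) ^ toℕ p

  -- The terms at the two equal columns have equal minors and opposite signs; the other minors still
  -- contain both columns, adjacent, and vanish by induction. `det-swapAdjacent` would only give
  -- `det A + det A ≈ 0`, which says too little in characteristic 2.
  det-equalAdjacent : (A : Matrix (suc n)) (p : Fin n) → (∀ i → A i (inject₁ p) ≈ A i (suc p)) → det A ≈ 0#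
  det-equalAdjacent {suc n} A p eq =
    sum-adjacent-cancel (laplaceTerm A) p other (opposite-signs p (eq zero) (det-cong minors))
    where
    minors : ∀ i k → minor (inject₁ p) A i k ≈ minor (suc p) A i k
    minors i k with punchIn-adjacent p k
    ... | inj₁ same        = reflexive (≡.cong (A (suc i)) same)
    ... | inj₂ (eq₁ , eq₂) rewrite eq₁ | eq₂ = sym (eq (suc i))
    other : ∀ j → j ≢ inject₁ p → j ≢ suc p → laplaceTerm A j ≈ 0#
    other j j≢p j≢sp with adjacent-preimage j p j≢p j≢sp
    ... | p′ , eq₁ , eq₂ = trans (*-congˡ (det-equalAdjacent (minor j A) p′ eq′)) (zeroʳ _)
      where
      eq′ : ∀ i → minor j A i (inject₁ p′) ≈ minor j A i (suc p′)
      eq′ i rewrite eq₁ | eq₂ = eq (suc i)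

  -- The term of `A` at p cancels the term of `B` at p + 1 and conversely; the remaining terms
  -- cancel index by index through the minors.
  det-swapAdjacent : (A B : Matrix (suc n)) (p : Fin n) →
                     (∀ i → A i (inject₁ p) ≈ B i (suc p)) → (∀ i → A i (suc p) ≈ B i (inject₁ p)) →
                     (∀ i j → j ≢ inject₁ p → j ≢ suc p → A i j ≈ B i j) → det A + det B ≈ 0#
  det-swapAdjacent {suc n} A B p A↓≈B↑ A↑≈B↓ A≈B = begin
    det A + det B  ≈⟨ ∑-distrib-+ (laplaceTerm A) (laplaceTerm B) ⟨
    sum (λ j → laplaceTerm A j + laplaceTerm B j)
      ≈⟨ sum-adjacent-cancel _ p other pair ⟩
    0# ∎
    where
    minors : ∀ i k → punchIn (inject₁ p) k ≡ punchIn (suc p) k ⊎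
                     (punchIn (inject₁ p) k ≡ suc p and punchIn (suc p) k ≡ inject₁ p) →
             A (suc i) (punchIn (inject₁ p) k) ≈ B (suc i) (punchIn (suc p) k) and
             A (suc i) (punchIn (suc p) k) ≈ B (suc i) (punchIn (inject₁ p) k)
    minors i k (inj₁ same) =
      (trans (A≈B (suc i) _ (punchInᵢ≢i (inject₁ p) k) ≢sp) (reflexive (≡.cong (B (suc i)) same))) ,
      (trans (reflexive (≡.cong (A (suc i)) (≡.sym same))) (A≈B (suc i) _ (punchInᵢ≢i (inject₁ p) k) ≢sp))
      where
      ≢sp : punchIn (inject₁ p) k ≢ suc p
      ≢sp eq = punchInᵢ≢i (suc p) k (≡.trans (≡.sym same) eq)
    minors i k (inj₂ (eq₁ , eq₂)) rewrite eq₁ | eq₂ = A↑≈B↓ (suc i) , A↓≈B↑ (suc i)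
    pair : laplaceTerm A (inject₁ p) + laplaceTerm B (inject₁ p) +
           (laplaceTerm A (suc p) + laplaceTerm B (suc p)) ≈ 0#
    pair = begin
      laplaceTerm A (inject₁ p) + laplaceTerm B (inject₁ p) + (laplaceTerm A (suc p) + laplaceTerm B (suc p))
        ≈⟨ solve 4 (λ a b c d → a :+ b :+ (c :+ d) := (a :+ d) :+ (b :+ c)) refl _ _ _ _ ⟩
      (laplaceTerm A (inject₁ p) + laplaceTerm B (suc p)) + (laplaceTerm B (inject₁ p) + laplaceTerm A (suc p))
        ≈⟨ +-cong (opposite-signs p (A↓≈B↑ zero) (det-cong λ i k → proj₁ (minors i k (punchIn-adjacent p k))))
                  (opposite-signs p (sym (A↑≈B↓ zero))
                    (det-cong λ i k → sym (proj₂ (minors i k (punchIn-adjacent p k))))) ⟩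
      0# + 0#  ≈⟨ +-identityˡ 0# ⟩
      0#       ∎
    other : ∀ j → j ≢ inject₁ p → j ≢ suc p → laplaceTerm A j + laplaceTerm B j ≈ 0#
    other j j≢p j≢sp with adjacent-preimage j p j≢p j≢sp
    ... | p′ , eq₁ , eq₂ = begin
      s * A zero j * det (minor j A) + s * B zero j * det (minor j B)
        ≈⟨ +-congʳ (*-congʳ (*-congˡ (A≈B zero j j≢p j≢sp))) ⟩
      s * B zero j * det (minor j A) + s * B zero j * det (minor j B)
        ≈⟨ distribˡ _ _ _ ⟨
      s * B zero j * (det (minor j A) + det (minor j B))
        ≈⟨ *-congˡ (det-swapAdjacent (minor j A) (minor j B) p′ down up rest) ⟩
      s * B zero j * 0#
        ≈⟨ zeroʳ _ ⟩
      0# ∎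
      where
      s = (- 1#) ^ toℕ j
      down : ∀ i → minor j A i (inject₁ p′) ≈ minor j B i (suc p′)
      down i rewrite eq₁ | eq₂ = A↓≈B↑ (suc i)
      up : ∀ i → minor j A i (suc p′) ≈ minor j B i (inject₁ p′)
      up i rewrite eq₁ | eq₂ = A↑≈B↓ (suc i)
      rest : ∀ i k → k ≢ inject₁ p′ → k ≢ suc p′ → minor j A i k ≈ minor j B i k
      rest i k k≢p k≢sp = A≈B (suc i) (punchIn j k)
        (λ eq → k≢p (punchIn-injective j _ _ (≡.trans eq (≡.sym eq₁))))
        (λ eq → k≢sp (punchIn-injective j _ _ (≡.trans eq (≡.sym eq₂))))

  -- Adjacent swaps carry the second copy leftwards until it stands next to the first column. Each
  -- swap only changes the sign, so vanishing is preserved.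
  det-equalToFirst : (A : Matrix (suc n)) (q : Fin n) → (∀ i → A i zero ≈ A i (suc q)) → det A ≈ 0#
  det-equalToFirst A q = go (toℕ q) A q ≡.refl
    where
    -- The induction is on the distance `toℕ q`, because after a swap the position is `inject₁ q`,
    -- which is not a subterm of `suc q`.
    go : ∀ {n} m (A : Matrix (suc n)) (q : Fin n) → toℕ q ≡ m → (∀ i → A i zero ≈ A i (suc q)) → det A ≈ 0#
    go m       A zero    q≡m       eq = det-equalAdjacent A zero eq
    go {suc n} (suc m) A (suc q) q≡m eq = begin
      det A          ≈⟨ +-identityʳ _ ⟨
      det A + 0#     ≈⟨ +-congˡ detB≈0 ⟨
      det A + det B  ≈⟨ det-swapAdjacent A B (suc q)
                          (λ i → reflexive (≡.cong (A i) (≡.sym (swapAt-suc (suc q)))))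
                          (λ i → reflexive (≡.cong (A i) (≡.sym (swapAt-inject₁ (suc q)))))
                          (λ i j j≢q j≢sq → reflexive (≡.cong (A i) (≡.sym (swapAt-other (suc q) j j≢q j≢sq)))) ⟩
      0#             ∎
      where
      B : Matrix (suc (suc n))
      B i j = A i (swapAt (suc q) j)
      detB≈0 : det B ≈ 0#
      detB≈0 = go m B (inject₁ q) (≡.trans (toℕ-inject₁ q) (ℕ.suc-injective q≡m))
        (λ i → trans (eq i) (reflexive (≡.cong (A i) (≡.sym (swapAt-inject₁ (suc q))))))

  -- The multiples are removed one column at a time. Linearity splits off `c p` times a determinant
  -- in which the first column occurs twice.
  det-addFirstColumn : (A B : Matrix (suc n)) (c : Fin n → Carrier) → (∀ i → A i zero ≈ B i zero) →
                       (∀ i j → A i (suc j) ≈ B i (suc j) + c j * B i zero) → det A ≈ det B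
  det-addFirstColumn {n} A B c A₀≈B₀ A≈ =
    go n ℕ.≤-refl A c A₀≈B₀ A≈ (λ j n≤j → ⊥-elim (ℕ.<⇒≱ (toℕ<n j) n≤j))
    where
    -- Invariant: `c` vanishes from index t on, so only the first t multiples are still to be
    -- removed; the next to go is the one at index t - 1.
    go : ∀ t → t ℕ.≤ n → (A : Matrix (suc n)) (c : Fin n → Carrier) → (∀ i → A i zero ≈ B i zero) →
         (∀ i j → A i (suc j) ≈ B i (suc j) + c j * B i zero) →
         (∀ j → t ℕ.≤ toℕ j → c j ≈ 0#) → det A ≈ det B
    go zero    t≤n A c A₀≈B₀ A≈ c≈0 = det-cong {A = A} {B = B} λ where
      i zero    → A₀≈B₀ i
      i (suc j) → trans (A≈ i j) (trans (+-congˡ (trans (*-congʳ (c≈0 j z≤n)) (zeroˡ _))) (+-identityʳ _))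
    go (suc t) t<n A c A₀≈B₀ A≈ c≈0 = begin
      det A                  ≈⟨ det-linear A M V (suc p) (c p) A≈M A≈V Aₚ≈ ⟩
      det M + c p * det V    ≈⟨ +-cong (go t (ℕ.<⇒≤ t<n) M c′ (λ i → refl) (λ i j → refl) c′≈0)
                                       (*-congˡ (det-equalToFirst V p (λ i → sym (Vₚ≈B₀ i)))) ⟩
      det B + c p * 0#       ≈⟨ +-congˡ (zeroʳ _) ⟩
      det B + 0#             ≈⟨ +-identityʳ _ ⟩
      det B                  ∎
      where
      p : Fin n
      p = fromℕ< t<n
      c′ : Fin n → Carrier
      c′ = updateAt c p (λ _ → 0#)
      M V : Matrix (suc n)
      M i zero    = B i zero
      M i (suc j) = B i (suc j) + c′ j * B i zero
      -- `V` repeats the first column at position `suc p`, hence has determinant 0.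
      V i = updateAt (M i) (suc p) (λ _ → B i zero)
      Vₚ≈B₀ : ∀ i → V i (suc p) ≈ B i zero
      Vₚ≈B₀ i = reflexive (updateAt-updates (suc p) (M i))
      A≈M : ∀ i j → j ≢ suc p → A i j ≈ M i j
      A≈M i zero    _    = A₀≈B₀ i
      A≈M i (suc j) j≢p = trans (A≈ i j)
        (+-congˡ (*-congʳ (reflexive (≡.sym (updateAt-minimal j p c (j≢p ∘ ≡.cong suc))))))
      A≈V : ∀ i j → j ≢ suc p → A i j ≈ V i j
      A≈V i j j≢p = trans (A≈M i j j≢p) (reflexive (≡.sym (updateAt-minimal j (suc p) (M i) j≢p)))
      Aₚ≈ : ∀ i → A i (suc p) ≈ M i (suc p) + c p * V i (suc p)
      Aₚ≈ i = begin
        A i (suc p)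
          ≈⟨ A≈ i p ⟩
        B i (suc p) + c p * B i zero
          ≈⟨ +-congʳ (+-identityʳ _) ⟨
        B i (suc p) + 0# + c p * B i zero
          ≈⟨ +-cong (+-congˡ (zeroˡ _)) (*-congˡ (Vₚ≈B₀ i)) ⟨
        B i (suc p) + 0# * B i zero + c p * V i (suc p)
          ≈⟨ +-congʳ (+-congˡ (*-congʳ (reflexive (updateAt-updates p c)))) ⟨
        M i (suc p) + c p * V i (suc p) ∎
      c′≈0 : ∀ j → t ℕ.≤ toℕ j → c′ j ≈ 0#
      c′≈0 j t≤j with j ≟ p
      ... | yes ≡.refl = reflexive (updateAt-updates p c)
      ... | no  j≢p    = trans (reflexive (updateAt-minimal j p c j≢p))
        (c≈0 j (ℕ.≤∧≢⇒< t≤j (λ t≡j → j≢p (toℕ-injective (≡.trans (≡.sym t≡j) (≡.sym (toℕ-fromℕ< t<n)))))))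

  -- The first column of `U` is the first unit vector, so `M` and `L` share their first column, and
  -- subtracting multiples of it removes the contribution of k = 0 from all other columns. What
  -- remains has first row (`L zero zero`, 0, ..., 0), and its minor is the product of the two
  -- factors without their first row and column.
  det-LU : (M L U : Matrix n) →
           (∀ i k → toℕ i ℕ.< toℕ k → L i k ≈ 0#) → (∀ k j → toℕ j ℕ.< toℕ k → U k j ≈ 0#) →
           (∀ k → U k k ≈ 1#) → (∀ i j → M i j ≈ sum (λ k → L i k * U k j)) →
           det M ≈ product (λ k → L k k)
  det-LU {zero}  M L U L-lower U-upper U-unit M≈LU = refl
  det-LU {suc n} M L U L-lower U-upper U-unit M≈LU = begin
    det M
      ≈⟨ det-addFirstColumn M B (λ j → U zero (suc j)) M₀≈ M≈ ⟩
    1# * L zero zero * det (minor zero B) + sum (λ j → laplaceTerm B (suc j))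
      ≈⟨ +-cong (*-cong (*-identityˡ _) (det-LU (minor zero B) (tail L) (tail U)
                   (λ i k i<k → L-lower (suc i) (suc k) (s≤s i<k)) (λ k j j<k → U-upper (suc k) (suc j) (s≤s j<k))
                   (λ k → U-unit (suc k)) (λ i j → refl)))
                (sum-identity _ row≈0) ⟩
    L zero zero * product (λ k → L (suc k) (suc k)) + 0#
      ≈⟨ +-identityʳ _ ⟩
    product (λ k → L k k) ∎
    where
    tail : Matrix (suc n) → Matrix n
    tail A i j = A (suc i) (suc j)
    -- `M` after subtracting `U zero (suc j)` times the first column from column `suc j`.
    B : Matrix (suc n)
    B i zero    = L i zero
    B i (suc j) = sum (λ k → L i (suc k) * U (suc k) (suc j))
    row≈0 : ∀ j → laplaceTerm B (suc j) ≈ 0#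
    row≈0 j = trans (*-congʳ (trans (*-congˡ B₀≈0) (zeroʳ _))) (zeroˡ _)
      where
      B₀≈0 : B zero (suc j) ≈ 0#
      B₀≈0 = sum-identity _ λ k → trans (*-congʳ (L-lower zero (suc k) (s≤s z≤n))) (zeroˡ _)
    M₀≈ : ∀ i → M i zero ≈ L i zero
    M₀≈ i = begin
      M i zero
        ≈⟨ M≈LU i zero ⟩
      L i zero * U zero zero + sum (λ k → L i (suc k) * U (suc k) zero)
        ≈⟨ +-cong (trans (*-congˡ (U-unit zero)) (*-identityʳ _))
                  (sum-identity _ λ k → trans (*-congˡ (U-upper (suc k) zero (s≤s z≤n))) (zeroʳ _)) ⟩
      L i zero + 0#
        ≈⟨ +-identityʳ _ ⟩
      L i zero ∎
    M≈ : ∀ i j → M i (suc j) ≈ B i (suc j) + U zero (suc j) * B i zero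
    M≈ i j = trans (M≈LU i (suc j)) (trans (+-comm _ _) (+-congˡ (*-comm _ _)))

-- The denominator of one level of the continued fraction

module DenominatorExpansion {c ℓ} (R : CommutativeRing c ℓ) where
  open CommutativeRing R
  open Algebra.Properties.Ring ring using (-‿distribʳ-*)
  open Algebra.Solver.Ring.NaturalCoefficients.Default commutativeSemiring
    using (solve; _:*_; _:=_)
  open Relation.Binary.Reasoning.Setoid setoid
  open RingNotation rawRing using (_^_)

  -- The right side keeps `z` outermost, so that coefficients can be compared after a shift, and
  -- keeps `T * (z * f)` together, since this is the expression that approximates the next column.
  expand-denominator : ∀ β λ′ z T f → f * (1# - β * z - λ′ * z ^ 2 * T) ≈
                       f - z * (β * f) - z * (λ′ * (T * (z * f)))
  expand-denominator β λ′ z T f = begin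
    f * (1# - β * z - λ′ * z ^ 2 * T)
      ≈⟨ distribˡ _ _ _ ⟩
    f * (1# - β * z) + f * - (λ′ * z ^ 2 * T)
      ≈⟨ +-cong (distribˡ _ _ _) (sym (-‿distribʳ-* _ _)) ⟩
    f * 1# + f * - (β * z) - f * (λ′ * z ^ 2 * T)
      ≈⟨ +-cong (+-cong (*-identityʳ f) (sym (-‿distribʳ-* _ _))) (-‿cong λ-term) ⟩
    f - f * (β * z) - z * (λ′ * (T * (z * f)))
      ≈⟨ +-congʳ (+-congˡ (-‿cong β-term)) ⟩
    f - z * (β * f) - z * (λ′ * (T * (z * f))) ∎
    where
    β-term : f * (β * z) ≈ z * (β * f)
    β-term = solve 3 (λ f β z → f :* (β :* z) := z :* (β :* f)) refl f β z
    λ-term : f * (λ′ * z ^ 2 * T) ≈ z * (λ′ * (T * (z * f)))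
    λ-term = trans (*-congˡ (*-congʳ (*-congˡ (*-congˡ (*-identityʳ z)))))
      (solve 4 (λ f l z T → f :* (l :* (z :* z) :* T) := z :* (l :* (T :* (z :* f)))) refl f λ′ z T)

-- Stieltjes matrices and the Hankel determinants of their moments

module StieltjesMatrix {c ℓ} (R : CommutativeRing c ℓ) (b lam : ℕ → CommutativeRing.Carrier R) where
  open CommutativeRing R hiding (zero)
  open Algebra.Properties.Ring ring using (-0#≈0#)
  open Algebra.Properties.Semiring.Sum semiring using (sum; sum-cong-≋; ∑-distrib-+)
  open Algebra.Solver.Ring.NaturalCoefficients.Default commutativeSemiring
    using (solve; _:+_; _:*_; _:=_)
  open Relation.Binary.Reasoning.Setoid setoid
  open RingNotation rawRing using (product)
  open DeterminantProperties R using (det-LU)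
  open MonoidSum +-commutativeMonoid using (sum-identity; sum-last)
  open Determinant rawRing using (hankelTransform)

  -- Weighted Motzkin paths: a rise has weight 1, a level step at height k weight `b k`, a fall from
  -- k + 1 to k weight `lam (suc k)`. The three summands are the three possible last steps.
  entry : ℕ → ℕ → Carrier
  entry zero    zero    = 1#
  entry zero    (suc k) = 0#
  entry (suc n) k       = prepend 0# (entry n) k + (b k * entry n k + lam (suc k) * entry n (suc k))

  entry-upper : ∀ n k → n ℕ.< k → entry n k ≈ 0#
  entry-upper zero    (suc k) _           = refl
  entry-upper (suc n) (suc k) (s≤s n<k) = begin
    entry n k + (b (suc k) * entry n (suc k) + lam (suc (suc k)) * entry n (suc (suc k)))
      ≈⟨ +-cong (entry-upper n k n<k)
           (+-cong (*-congˡ (entry-upper n (suc k) n<1+k))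
                   (*-congˡ (entry-upper n (suc (suc k)) (ℕ.m<n⇒m<1+n n<1+k)))) ⟩
    0# + (b (suc k) * 0# + lam (suc (suc k)) * 0#)
      ≈⟨ +-congˡ (+-cong (zeroʳ _) (zeroʳ _)) ⟩
    0# + (0# + 0#)
      ≈⟨ trans (+-identityˡ _) (+-identityˡ _) ⟩
    0# ∎
    where n<1+k = ℕ.m<n⇒m<1+n n<k

  entry-diagonal : ∀ n → entry n n ≈ 1#
  entry-diagonal zero    = refl
  entry-diagonal (suc n) = begin
    entry n n + (b (suc n) * entry n (suc n) + lam (suc (suc n)) * entry n (suc (suc n)))
      ≈⟨ +-cong (entry-diagonal n)
           (+-cong (*-congˡ (entry-upper n (suc n) n<1+n))
                   (*-congˡ (entry-upper n (suc (suc n)) (ℕ.m<n⇒m<1+n n<1+n)))) ⟩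
    1# + (b (suc n) * 0# + lam (suc (suc n)) * 0#)
      ≈⟨ +-congˡ (trans (+-cong (zeroʳ _) (zeroʳ _)) (+-identityˡ 0#)) ⟩
    1# + 0#
      ≈⟨ +-identityʳ 1# ⟩
    1# ∎
    where n<1+n = ℕ.n<1+n n

  weight : ℕ → Carrier
  weight zero    = 1#
  weight (suc k) = weight k * lam (suc k)

  -- `weight k * entry j k` weighs the j-step paths from height k down to 0: reading a path
  -- backwards turns its k unmatched rises into falls. `N` cuts off the heights, without loss once i
  -- ≤ N because `entry i k` vanishes for k > i.
  pairing : ℕ → ℕ → ℕ → Carrier
  pairing N i j = sum {suc N} (λ k → entry i (toℕ k) * weight (toℕ k) * entry j (toℕ k))

  -- Since `weight (suc k)` is `weight k * lam (suc k)`, reindexing shows that the shift k ↦ k - 1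
  -- and the opposite shift multiplied by `lam` are adjoint. The right side has one more term, at k
  -- = N, which `boundary` removes.
  sum-shift : ∀ N (f g : ℕ → Carrier) → f N * g (suc N) ≈ 0# →
              sum {suc N} (λ k → prepend 0# f (toℕ k) * weight (toℕ k) * g (toℕ k)) ≈
              sum {suc N} (λ k → f (toℕ k) * weight (toℕ k) * (lam (suc (toℕ k)) * g (suc (toℕ k))))
  sum-shift N f g boundary = begin
    0# * 1# * g 0 + sum {N} (λ k → f (toℕ k) * (weight (toℕ k) * lam (suc (toℕ k))) * g (suc (toℕ k)))
      ≈⟨ +-cong (trans (*-congʳ (zeroˡ _)) (zeroˡ _))
           (sum-cong-≋ {N} λ k → reassoc (f (toℕ k)) (weight (toℕ k)) (lam (suc (toℕ k))) (g (suc (toℕ k)))) ⟩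
    0# + sum {N} (t ∘ toℕ)
      ≈⟨ +-comm _ _ ⟩
    sum {N} (t ∘ toℕ) + 0#
      ≈⟨ +-congˡ t-last ⟨
    sum {N} (t ∘ toℕ) + t N
      ≈⟨ sum-last N t ⟨
    sum {suc N} (t ∘ toℕ) ∎
    where
    t : ℕ → Carrier
    t k = f k * weight k * (lam (suc k) * g (suc k))
    reassoc : ∀ x w l y → x * (w * l) * y ≈ x * w * (l * y)
    reassoc = solve 4 (λ x w l y → x :* (w :* l) :* y := x :* w :* (l :* y)) refl
    t-last : t N ≈ 0#
    t-last = begin
      f N * weight N * (lam (suc N) * g (suc N))
        ≈⟨ solve 4 (λ x w l y → x :* w :* (l :* y) := w :* l :* (x :* y)) refl _ _ _ _ ⟩
      weight N * lam (suc N) * (f N * g (suc N))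
        ≈⟨ trans (*-congˡ boundary) (zeroʳ _) ⟩
      0# ∎

  -- The tridiagonal recurrence is symmetric for the weighted pairing, so one step moves from the
  -- left index to the right. The bound i < N kills both boundary terms, through `entry i N` and
  -- `entry i (suc N)`; j stays unrestricted.
  pairing-slide : ∀ N i j → i ℕ.< N → pairing N (suc i) j ≈ pairing N i (suc j)
  pairing-slide N i j i<N = begin
    pairing N (suc i) j
      ≈⟨ sum-cong-≋ {suc N} (λ k → splitˡ (prepend 0# (entry i) (toℕ k)) (b (toℕ k)) (entry i (toℕ k))
                                    (lam (suc (toℕ k)) * entry i (suc (toℕ k))) (weight (toℕ k)) (entry j (toℕ k))) ⟩
    sum {suc N} (λ k → X i j k + (Y i j k + Z j i k))
      ≈⟨ ∑-distrib-+ {suc N} (X i j) (λ k → Y i j k + Z j i k) ⟩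
    sum {suc N} (X i j) + sum {suc N} (λ k → Y i j k + Z j i k)
      ≈⟨ +-congˡ (∑-distrib-+ {suc N} (Y i j) (Z j i)) ⟩
    sum {suc N} (X i j) + (sum {suc N} (Y i j) + sum {suc N} (Z j i))
      -- Rises on one side are traded for falls on the other, once in each direction; the level
      -- steps `Y` are symmetric already.
      ≈⟨ +-cong (sum-shift N (entry i) (entry j) (trans (*-congʳ (entry-upper i N i<N)) (zeroˡ _)))
           (+-congˡ (sym (sum-shift N (entry j) (entry i)
             (trans (*-congˡ (entry-upper i (suc N) (ℕ.m<n⇒m<1+n i<N))) (zeroʳ _))))) ⟩
    sum {suc N} (Z i j) + (sum {suc N} (Y i j) + sum {suc N} (X j i))
      ≈⟨ solve 3 (λ x y z → z :+ (y :+ x) := x :+ (y :+ z)) refl _ _ _ ⟩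
    sum {suc N} (X j i) + (sum {suc N} (Y i j) + sum {suc N} (Z i j))
      ≈⟨ +-congˡ (∑-distrib-+ {suc N} (Y i j) (Z i j)) ⟨
    sum {suc N} (X j i) + sum {suc N} (λ k → Y i j k + Z i j k)
      ≈⟨ ∑-distrib-+ {suc N} (X j i) (λ k → Y i j k + Z i j k) ⟨
    sum {suc N} (λ k → X j i k + (Y i j k + Z i j k))
      ≈⟨ sum-cong-≋ {suc N} (λ k → splitʳ (prepend 0# (entry j) (toℕ k)) (b (toℕ k)) (entry j (toℕ k))
                                    (lam (suc (toℕ k)) * entry j (suc (toℕ k))) (weight (toℕ k)) (entry i (toℕ k))) ⟨
    pairing N i (suc j) ∎
    where
    X Y Z : ℕ → ℕ → Fin (suc N) → Carrier
    X i j k = prepend 0# (entry i) (toℕ k) * weight (toℕ k) * entry j (toℕ k)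
    Y i j k = b (toℕ k) * (entry i (toℕ k) * weight (toℕ k) * entry j (toℕ k))
    Z i j k = entry i (toℕ k) * weight (toℕ k) * (lam (suc (toℕ k)) * entry j (suc (toℕ k)))
    splitˡ : ∀ s β x l w y → (s + (β * x + l)) * w * y ≈ s * w * y + (β * (x * w * y) + y * w * l)
    splitˡ = solve 6 (λ s β x l w y → (s :+ (β :* x :+ l)) :* w :* y :=
                        s :* w :* y :+ (β :* (x :* w :* y) :+ y :* w :* l)) refl
    splitʳ : ∀ s β y l w x → x * w * (s + (β * y + l)) ≈ s * w * x + (β * (x * w * y) + x * w * l)
    splitʳ = solve 6 (λ s β y l w x → x :* w :* (s :+ (β :* y :+ l)) :=
                        s :* w :* x :+ (β :* (x :* w :* y) :+ x :* w :* l)) refl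

  pairing≈moment : ∀ N i j → i ℕ.≤ N → pairing N i j ≈ entry (i ℕ.+ j) 0
  pairing≈moment N zero    j _   = begin
    1# * 1# * entry j 0 + sum {N} (λ k → 0# * weight (suc (toℕ k)) * entry j (suc (toℕ k)))
      ≈⟨ +-cong (trans (*-congʳ (*-identityˡ 1#)) (*-identityˡ _))
                (sum-identity {N} _ (λ k → trans (*-congʳ (zeroˡ (weight (suc (toℕ k))))) (zeroˡ _))) ⟩
    entry j 0 + 0#
      ≈⟨ +-identityʳ _ ⟩
    entry j 0 ∎
  pairing≈moment N (suc i) j i<N = begin
    pairing N (suc i) j        ≈⟨ pairing-slide N i j i<N ⟩
    pairing N i (suc j)        ≈⟨ pairing≈moment N i (suc j) (ℕ.<⇒≤ i<N) ⟩
    entry (i ℕ.+ suc j) 0      ≈⟨ reflexive (≡.cong (λ n → entry n 0) (ℕ.+-suc i j)) ⟩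
    entry (suc i ℕ.+ j) 0      ∎

  hankelTransform-moments : ∀ n → hankelTransform (λ i → entry i 0) n ≈ product {suc n} (weight ∘ toℕ)
  hankelTransform-moments n = trans
    -- The weights all go into the lower factor, so that the upper one keeps the unit diagonal of
    -- `entry`. The cutoff n serves every row, since row indices are at most n.
    (det-LU {suc n} _ (λ i k → entry (toℕ i) (toℕ k) * weight (toℕ k)) (λ k j → entry (toℕ j) (toℕ k))
      (λ i k i<k → trans (*-congʳ (entry-upper (toℕ i) (toℕ k) i<k)) (zeroˡ _))
      (λ k j j<k → entry-upper (toℕ j) (toℕ k) j<k)
      (λ k → entry-diagonal (toℕ k))
      (λ i j → sym (pairing≈moment n (toℕ i) (toℕ j) (ℕ.s≤s⁻¹ (toℕ<n i)))))
    (product-cong {suc n} λ k → trans (*-congʳ (entry-diagonal (toℕ k))) (*-identityˡ (weight (toℕ k))))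
    where
    open Algebra.Properties.CommutativeMonoid.Sum *-commutativeMonoid
      using () renaming (sum-cong-≋ to product-cong)

  -- Columns of the Stieltjes matrix and the continued fraction

  open PowerSeries rawRing using (Series; const; z; seriesRing; 1/_; _⟶_)
  open ContinuedFraction rawRing
  open SeriesProperties R
  open DenominatorExpansion seriesCommutativeRing using (expand-denominator)
  private module S = CommutativeRing seriesCommutativeRing
  open S using () renaming (_*_ to _⊛_)
  open RingNotation seriesRing using () renaming (_-_ to _⊝_; _^_ to _⊛^_)

  z⊛-zero : ∀ f → (z ⊛ f) 0 ≈ 0#
  z⊛-zero f = trans (+-identityʳ _) (zeroˡ _)

  z⊛-suc : ∀ f n → (z ⊛ f) (suc n) ≈ f n
  z⊛-suc f n = begin
    0# * f (suc n) + ((z ∘ suc) ⊛ f) n  ≈⟨ +-cong (zeroˡ _) (⊛-cong-≤ (z ∘ suc) (const 1#) f f n (λ j _ → tail-z j) (λ _ _ → refl)) ⟩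
    0# + (const 1# ⊛ f) n               ≈⟨ +-identityˡ _ ⟩
    (const 1# ⊛ f) n                    ≈⟨ S.*-identityˡ f n ⟩
    f n                                 ∎
    where
    tail-z : ∀ j → z (suc j) ≈ const 1# j
    tail-z zero    = refl
    tail-z (suc j) = refl

  z⊛const⊛-suc : ∀ a f n → (z ⊛ (const a ⊛ f)) (suc n) ≈ a * f n
  z⊛const⊛-suc a f n = trans (z⊛-suc (const a ⊛ f) n) (const⊛ a f n)

  column : ℕ → Series
  column k n = entry n k

  previous : ℕ → Series
  previous zero    = const 1#
  previous (suc k) = z ⊛ column k

  column-recurrence : ∀ k n → column k n ≈
    (previous k S.+ (z ⊛ (const (b k) ⊛ column k) S.+ z ⊛ (const (lam (suc k)) ⊛ column (suc k)))) n
  column-recurrence k zero    = sym (begin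
    previous k 0 + ((z ⊛ (const (b k) ⊛ column k)) 0 + (z ⊛ (const (lam (suc k)) ⊛ column (suc k))) 0)
      ≈⟨ +-cong (initial k) (+-cong (z⊛-zero (const (b k) ⊛ column k)) (z⊛-zero (const (lam (suc k)) ⊛ column (suc k)))) ⟩
    column k 0 + (0# + 0#)
      ≈⟨ trans (+-congˡ (+-identityˡ 0#)) (+-identityʳ _) ⟩
    column k 0 ∎)
    where
    initial : ∀ k → previous k 0 ≈ column k 0
    initial zero    = refl
    initial (suc k) = z⊛-zero (column k)
  column-recurrence k (suc n) = sym (+-cong (step k)
    (+-cong (z⊛const⊛-suc (b k) (column k) n) (z⊛const⊛-suc (lam (suc k)) (column (suc k)) n)))
    where
    step : ∀ k → previous k (suc n) ≈ prepend 0# (entry n) k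
    step zero    = refl
    step (suc k) = z⊛-suc (column k) n

  denominator : ℕ → Series → Series
  denominator k T = S.1# ⊝ const (b k) ⊛ z ⊝ const (lam (suc k)) ⊛ z ⊛^ 2 ⊛ T

  denominator-zero : ∀ k T → denominator k T 0 ≈ 1#
  denominator-zero k T = begin
    1# + - u + - v       ≈⟨ +-cong (+-congˡ (-‿cong u≈0)) (-‿cong v≈0) ⟩
    1# + - 0# + - 0#     ≈⟨ +-cong (+-congˡ -0#≈0#) -0#≈0# ⟩
    1# + 0# + 0#         ≈⟨ trans (+-identityʳ _) (+-identityʳ _) ⟩
    1#                   ∎
    where
    u = (const (b k) ⊛ z) 0
    v = (const (lam (suc k)) ⊛ z ⊛^ 2 ⊛ T) 0
    u≈0 : u ≈ 0#
    u≈0 = trans (+-identityʳ _) (zeroʳ _)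
    v≈0 : v ≈ 0#
    v≈0 = trans (+-identityʳ _) (trans (*-congʳ (trans (+-identityʳ _)
            (trans (*-congˡ (z⊛-zero (z ⊛ S.1#))) (zeroʳ _)))) (zeroˡ _))

  -- The error in `C⁺≈` enters the recurrence only behind a factor z, so agreement below n at level
  -- k + 1 becomes agreement below n + 1 at level k.
  column⊛denominator : ∀ n k T → (∀ j → j ℕ.< n → column (suc k) j ≈ (T ⊛ (z ⊛ column k)) j) →
                       ∀ j → j ℕ.< suc n → (column k ⊛ denominator k T) j ≈ previous k j
  column⊛denominator n k T C⁺≈ j j<1+n = begin
    (column k ⊛ denominator k T) j
      ≈⟨ expand-denominator (const (b k)) λ′ z T (column k) j ⟩
    column k j + - u + - v
      ≈⟨ +-congʳ (+-congʳ (column-recurrence k j)) ⟩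
    previous k j + (u + v⁺) + - u + - v
      ≈⟨ +-congʳ (+-congʳ (+-congˡ (+-congˡ (v⁺≈v j j<1+n)))) ⟩
    previous k j + (u + v) + - u + - v
      ≈⟨ trans (+-assoc _ _ _) (+-congˡ (-‿+-comm u v)) ⟩
    previous k j + (u + v) + - (u + v)
      ≈⟨ trans (+-assoc _ _ _) (+-congˡ (-‿inverseʳ _)) ⟩
    previous k j + 0#
      ≈⟨ +-identityʳ _ ⟩
    previous k j ∎
    where
    open Algebra.Properties.Ring ring using (-‿+-comm)
    λ′ = const (lam (suc k))
    u = (z ⊛ (const (b k) ⊛ column k)) j
    v = (z ⊛ (λ′ ⊛ (T ⊛ (z ⊛ column k)))) j
    v⁺ = (z ⊛ (λ′ ⊛ column (suc k))) j
    v⁺≈v : ∀ j → j ℕ.< suc n → (z ⊛ (λ′ ⊛ column (suc k))) j ≈ (z ⊛ (λ′ ⊛ (T ⊛ (z ⊛ column k)))) j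
    v⁺≈v zero    _         = trans (z⊛-zero (λ′ ⊛ column (suc k))) (sym (z⊛-zero (λ′ ⊛ (T ⊛ (z ⊛ column k)))))
    v⁺≈v (suc j) (s≤s j<n) = begin
      (z ⊛ (λ′ ⊛ column (suc k))) (suc j)             ≈⟨ z⊛const⊛-suc (lam (suc k)) (column (suc k)) j ⟩
      lam (suc k) * column (suc k) j                  ≈⟨ *-congˡ (C⁺≈ j j<n) ⟩
      lam (suc k) * (T ⊛ (z ⊛ column k)) j            ≈⟨ z⊛const⊛-suc (lam (suc k)) (T ⊛ (z ⊛ column k)) j ⟨
      (z ⊛ (λ′ ⊛ (T ⊛ (z ⊛ column k)))) (suc j)       ∎

  -- Induction on n with k free, because the tail of the fraction starts one level higher. For n = 0
  -- there is no index j, so the induction starts empty; each level then contributes one order of z.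
  column≈truncationFrom : ∀ n k j → j ℕ.< n → column k j ≈ (truncationFrom b lam k n ⊛ previous k) j
  column≈truncationFrom (suc n) k j j<1+n = begin
    column k j                                ≈⟨ S.*-identityʳ (column k) j ⟨
    (column k ⊛ S.1#) j                       ≈⟨ S.*-congˡ {column k} (1/-inverseʳ den (denominator-zero k T)) j ⟨
    (column k ⊛ (den ⊛ 1/ den)) j             ≈⟨ S.*-assoc (column k) den (1/ den) j ⟨
    -- `Cden≈previous` is available up to index j, which is all that this coefficient of the product
    -- sees.
    (column k ⊛ den ⊛ 1/ den) j               ≈⟨ ⊛-cong-≤ (column k ⊛ den) (previous k) (1/ den) (1/ den) j
                                                   Cden≈previous (λ _ _ → refl) ⟩
    (previous k ⊛ 1/ den) j                   ≈⟨ S.*-comm (previous k) (1/ den) j ⟩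
    (1/ den ⊛ previous k) j                   ∎
    where
    T = truncationFrom b lam (suc k) n
    den = denominator k T
    Cden≈previous : ∀ i → i ℕ.≤ j → (column k ⊛ den) i ≈ previous k i
    Cden≈previous i i≤j =
      column⊛denominator n k T (column≈truncationFrom n (suc k)) i (ℕ.≤-<-trans i≤j j<1+n)

  truncation⟶moments : truncation b lam ⟶ (λ n → entry n 0)
  truncation⟶moments k = k , λ n k≤n j j<k →
    sym (trans (column≈truncationFrom n 0 j (ℕ.<-≤-trans j<k k≤n))
               (S.*-identityʳ (truncation b lam n) j))

-- The recurrence of the Whitney numbers

S-zero : ∀ n k → n ℕ.< k → S n k ≡ 0
S-zero zero    (suc k) _         = ≡.refl
S-zero (suc n) (suc k) (s≤s n<k)
  rewrite S-zero n (suc k) (ℕ.m<n⇒m<1+n n<k) | S-zero n k n<k = ≡.trans (ℕ.+-identityʳ (k ℕ.* 0)) (ℕ.*-zeroʳ k)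

module WhitneyRecurrence {c ℓ} (K : CommutativeRing c ℓ) (m : CommutativeRing.Carrier K) where
  open CommutativeRing K hiding (zero)
  open Algebra.Properties.Semiring.Mult semiring
    using (_×_; ×-congˡ; ×-congʳ; ×-homo-1; ×-homo-+; ×1-homo-*; ×-assoc-*)
  open Algebra.Properties.Semiring.Sum semiring using (sum-cong-≋; ∑-distrib-+)
  open Algebra.Solver.Ring.NaturalCoefficients.Default commutativeSemiring
    using (solve; _:+_; _:*_; _:=_)
  open Relation.Binary.Reasoning.Setoid setoid
  open RingNotation rawRing using (_^_; ∑)
  open MonoidSum +-commutativeMonoid using (sum-last)
  open Dowling rawRing m using (W)

  -- This is (1 + E)^n applied to f and read at 0, where E is the shift of sequences. The recursive
  -- form has Pascal's rule built in, so passing from n to n + 1 only requires knowing the shifted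
  -- sequence.
  binomialTransform : ℕ → (ℕ → Carrier) → Carrier
  binomialTransform zero    f = f 0
  binomialTransform (suc n) f = binomialTransform n f + binomialTransform n (f ∘ suc)

  binomialTransform-cong : ∀ n {f g} → (∀ i → f i ≈ g i) → binomialTransform n f ≈ binomialTransform n g
  binomialTransform-cong zero    f≈g = f≈g 0
  binomialTransform-cong (suc n) f≈g = +-cong (binomialTransform-cong n f≈g) (binomialTransform-cong n (f≈g ∘ suc))

  binomialTransform-linear : ∀ n f a g → binomialTransform n (λ i → f i + a * g i) ≈
                             binomialTransform n f + a * binomialTransform n g
  binomialTransform-linear zero    f a g = refl
  binomialTransform-linear (suc n) f a g = begin
    binomialTransform n (λ i → f i + a * g i) + binomialTransform n (λ i → f (suc i) + a * g (suc i))
      ≈⟨ +-cong (binomialTransform-linear n f a g) (binomialTransform-linear n (f ∘ suc) a (g ∘ suc)) ⟩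
    binomialTransform n f + a * binomialTransform n g +
    (binomialTransform n (f ∘ suc) + a * binomialTransform n (g ∘ suc))
      ≈⟨ solve 5 (λ a p q r s → p :+ a :* q :+ (r :+ a :* s) := p :+ r :+ a :* (q :+ s)) refl a _ _ _ _ ⟩
    binomialTransform (suc n) f + a * binomialTransform (suc n) g ∎

  binomialTransform-zero : ∀ n → binomialTransform n (λ _ → 0#) ≈ 0#
  binomialTransform-zero zero    = refl
  binomialTransform-zero (suc n) = trans (+-cong (binomialTransform-zero n) (binomialTransform-zero n)) (+-identityˡ 0#)

  binomialTransform≈∑ : ∀ n f → binomialTransform n f ≈ ∑ 0 n (λ i → (n C i) × f i)
  binomialTransform≈∑ zero    f = sym (trans (+-identityʳ _) (×-homo-1 (f 0)))
  binomialTransform≈∑ (suc n) f = begin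
    binomialTransform n f + binomialTransform n (f ∘ suc)
      ≈⟨ +-cong (binomialTransform≈∑ n f) (binomialTransform≈∑ n (f ∘ suc)) ⟩
    ∑ 0 n (λ i → (n C i) × f i) + ∑ 0 n (λ i → (n C i) × f (suc i))
      -- The added term has binomial coefficient n C (n+1) = 0. With it the first sum runs to n + 1,
      -- and removing its head aligns it with the second sum for Pascal's rule.
      ≈⟨ +-congʳ (trans (+-congˡ (×-congˡ (k>n⇒nCk≡0 (ℕ.n<1+n n)))) (+-identityʳ _)) ⟨
    (∑ 0 n t + t (suc n)) + ∑ 0 n (λ i → (n C i) × f (suc i))
      ≈⟨ +-congʳ (sum-last (suc n) t) ⟨
    (1 × f 0 + ∑ 0 n (t ∘ suc)) + ∑ 0 n (λ i → (n C i) × f (suc i))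
      ≈⟨ trans (+-assoc _ _ _) (+-congˡ (trans (+-comm _ _) (sym
           (∑-distrib-+ {suc n} (λ i → (n C toℕ i) × f (suc (toℕ i))) (t ∘ suc ∘ toℕ))))) ⟩
    1 × f 0 + ∑ 0 n (λ i → (n C i) × f (suc i) + (n C suc i) × f (suc i))
      ≈⟨ +-congˡ (sum-cong-≋ {suc n} (λ i → trans (sym (×-homo-+ (f (suc (toℕ i))) (n C toℕ i) (n C suc (toℕ i))))
                                                  (×-congˡ (nCk+nC[k+1]≡[n+1]C[k+1] n (toℕ i))))) ⟩
    ∑ 0 (suc n) (λ i → (suc n C i) × f i) ∎
    where
    t : ℕ → Carrier
    t i = (n C i) × f i

  -- Used on the summands of `W n k`, which vanish below k: all sums then start at 0 and the range
  -- no longer depends on k.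
  ∑-extend : ∀ k n (g : ℕ → Carrier) → (∀ i → i ℕ.< k → g i ≈ 0#) → ∑ k n g ≈ ∑ 0 n g
  ∑-extend zero          n       g g≈0 = refl
  ∑-extend (suc zero)    zero    g g≈0 = sym (trans (+-identityʳ _) (g≈0 0 (s≤s z≤n)))
  ∑-extend (suc (suc k)) zero    g g≈0 = sym (trans (+-identityʳ _) (g≈0 0 (s≤s z≤n)))
  ∑-extend (suc k)       (suc n) g g≈0 = begin
    ∑ k n (g ∘ suc)          ≈⟨ ∑-extend k n (g ∘ suc) (λ i i<k → g≈0 (suc i) (s≤s i<k)) ⟩
    ∑ 0 n (g ∘ suc)          ≈⟨ +-identityˡ _ ⟨
    0# + ∑ 0 n (g ∘ suc)     ≈⟨ +-congʳ (g≈0 0 (s≤s z≤n)) ⟨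
    ∑ 0 (suc n) g            ∎

  stirlingTerm : ℕ → ℕ → Carrier
  stirlingTerm k i = m ^ (i ∸ k) * (S i k × 1#)

  stirlingTerm-zero : ∀ k i → i ℕ.< k → stirlingTerm k i ≈ 0#
  stirlingTerm-zero k i i<k = trans (*-congˡ (×-congˡ (S-zero i k i<k))) (zeroʳ _)

  W≈binomialTransform : ∀ n k → W n k ≈ binomialTransform n (stirlingTerm k)
  W≈binomialTransform n k = trans
    (∑-extend k n (λ i → (n C i) × stirlingTerm k i)
      (λ i i<k → trans (×-congʳ (n C i) (stirlingTerm-zero k i i<k)) (×-zero (n C i))))
    (sym (binomialTransform≈∑ n (stirlingTerm k)))
    where
    ×-zero : ∀ n → n × 0# ≈ 0#
    ×-zero zero    = refl
    ×-zero (suc n) = trans (+-identityˡ _) (×-zero n)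

  -- The Stirling recurrence multiplied by the power of m. In the summand that keeps k, the exponent
  -- grows by one, which turns the factor k into k m.
  stirlingTerm-suc : ∀ k i → stirlingTerm k (suc i) ≈
                     prepend 0# (λ k → stirlingTerm k i) k + (k × m) * stirlingTerm k i
  stirlingTerm-suc zero    i = trans (zeroʳ _) (sym (trans (+-identityˡ _) (zeroˡ _)))
  stirlingTerm-suc (suc k) i = begin
    p * ((suc k ℕ.* S i (suc k) ℕ.+ S i k) × 1#)
      ≈⟨ *-congˡ (trans (×-homo-+ 1# (suc k ℕ.* S i (suc k)) (S i k)) (+-congʳ (×1-homo-* (suc k) (S i (suc k))))) ⟩
    p * ((suc k × 1#) * s + S i k × 1#)
      ≈⟨ solve 4 (λ p a s t → p :* (a :* s :+ t) := p :* t :+ a :* (p :* s)) refl p _ s _ ⟩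
    stirlingTerm k i + (suc k × 1#) * (p * s)
      ≈⟨ +-congˡ (*-congˡ peel) ⟩
    stirlingTerm k i + (suc k × 1#) * (m * stirlingTerm (suc k) i)
      ≈⟨ +-congˡ (trans (sym (*-assoc _ _ _)) (*-congʳ (trans (×-assoc-* (suc k) 1# m) (×-congʳ (suc k) (*-identityˡ m))))) ⟩
    stirlingTerm k i + (suc k × m) * stirlingTerm (suc k) i ∎
    where
    p = m ^ (i ∸ k)
    s = S i (suc k) × 1#
    -- A factor m can be taken out of `m ^ (i ∸ k)` only if k < i. Otherwise the exponent is cut off
    -- at 0, but then S i (k+1) = 0 and both sides vanish.
    peel : p * s ≈ m * stirlingTerm (suc k) i
    peel with k ℕ.<? i
    ... | yes k<i = trans (*-congʳ (reflexive (≡.cong (m ^_) (ℕ.+-∸-assoc 1 k<i)))) (*-assoc _ _ _)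
    ... | no  k≮i = trans (trans (*-congˡ s≈0) (zeroʳ _))
                            (sym (trans (*-congˡ (trans (*-congˡ s≈0) (zeroʳ _))) (zeroʳ _)))
      where
      s≈0 : s ≈ 0#
      s≈0 = ×-congˡ (S-zero i (suc k) (s≤s (ℕ.≮⇒≥ k≮i)))

  W-initial : ∀ k → W 0 k ≈ S 0 k × 1#
  W-initial k = trans (W≈binomialTransform 0 k) (trans (*-congʳ (reflexive (≡.cong (m ^_) (ℕ.0∸n≡0 k)))) (*-identityˡ _))

  -- The summand `W n k` with factor 1 is due to the Pascal step of the binomial transform; the
  -- factor k m and the shift to k - 1 are due to the Stirling recurrence.
  W-suc : ∀ n k → W (suc n) k ≈ prepend 0# (W n) k + (W n k + (k × m) * W n k)
  W-suc n k = begin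
    W (suc n) k
      ≈⟨ W≈binomialTransform (suc n) k ⟩
    T k + binomialTransform n (stirlingTerm k ∘ suc)
      ≈⟨ +-congˡ (binomialTransform-cong n (stirlingTerm-suc k)) ⟩
    T k + binomialTransform n (λ i → prepend 0# (λ k → stirlingTerm k i) k + (k × m) * stirlingTerm k i)
      ≈⟨ +-congˡ (binomialTransform-linear n (λ i → prepend 0# (λ k → stirlingTerm k i) k) (k × m) (stirlingTerm k)) ⟩
    T k + (binomialTransform n (λ i → prepend 0# (λ k → stirlingTerm k i) k) + (k × m) * T k)
      ≈⟨ solve 3 (λ t s u → t :+ (s :+ u) := s :+ (t :+ u)) refl _ _ _ ⟩
    binomialTransform n (λ i → prepend 0# (λ k → stirlingTerm k i) k) + (T k + (k × m) * T k)
      ≈⟨ +-cong (shifted k) (+-cong T≈W (*-congˡ T≈W)) ⟩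
    prepend 0# (W n) k + (W n k + (k × m) * W n k) ∎
    where
    T : ℕ → Carrier
    T k = binomialTransform n (stirlingTerm k)
    T≈W = sym (W≈binomialTransform n k)
    shifted : ∀ k → binomialTransform n (λ i → prepend 0# (λ k → stirlingTerm k i) k) ≈ prepend 0# (W n) k
    shifted zero    = binomialTransform-zero n
    shifted (suc k) = sym (W≈binomialTransform n k)

-- Hasse derivatives of Dowling polynomials as Stieltjes entries

module DowlingMoments {c ℓ} (R : CommutativeRing c ℓ) (μ x : CommutativeRing.Carrier R) where
  open CommutativeRing R hiding (zero)
  open Algebra.Properties.Semiring.Exp semiring using (^-homo-*; ^-congʳ)
  open Algebra.Properties.Semiring.Mult semiring
    using (_×_; ×-congʳ; ×1-homo-*; ×-assoc-*)
  open Algebra.Properties.Semiring.Sum semiring using (*-distribˡ-sum; sum; sum-cong-≋)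
  open Algebra.Solver.Ring.NaturalCoefficients.Default commutativeSemiring
    using (solve; con; _:+_; _:*_; _:=_)
  open Relation.Binary.Reasoning.Setoid setoid
  open RingNotation rawRing using (_^_; ∑; product)
  open MonoidSum *-commutativeMonoid using () renaming (sum-last to product-last)

  b lam : ℕ → Carrier
  b n = x + n × μ + 1#
  lam n = n × (μ * x)

  open StieltjesMatrix R b lam using (entry; weight)

  -- The k-th Hasse derivative at x of the polynomial with coefficients g 0, …, g (N ∸ 1).
  hasse : ℕ → ℕ → (ℕ → Carrier) → Carrier
  hasse zero    k       g = 0#
  hasse (suc N) zero    g = x * hasse N 0 (g ∘ suc) + g 0
  hasse (suc N) (suc k) g = x * hasse N (suc k) (g ∘ suc) + hasse N k (g ∘ suc)

  hasse-cong : ∀ N k {f g} → (∀ j → f j ≈ g j) → hasse N k f ≈ hasse N k g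
  hasse-cong zero    k       f≈g = refl
  hasse-cong (suc N) zero    f≈g = +-cong (*-congˡ (hasse-cong N 0 (f≈g ∘ suc))) (f≈g 0)
  hasse-cong (suc N) (suc k) f≈g = +-cong (*-congˡ (hasse-cong N (suc k) (f≈g ∘ suc))) (hasse-cong N k (f≈g ∘ suc))

  hasse-linear : ∀ N k f a g → hasse N k (λ j → f j + a * g j) ≈ hasse N k f + a * hasse N k g
  hasse-linear zero    k       f a g = sym (trans (+-identityˡ _) (zeroʳ a))
  hasse-linear (suc N) zero    f a g = trans (+-congʳ (*-congˡ (hasse-linear N 0 (f ∘ suc) a (g ∘ suc))))
    (solve 6 (λ x p a q s t → x :* (p :+ a :* q) :+ (s :+ a :* t) := x :* p :+ s :+ a :* (x :* q :+ t)) refl x _ a _ _ _)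
  hasse-linear (suc N) (suc k) f a g =
    trans (+-cong (*-congˡ (hasse-linear N (suc k) (f ∘ suc) a (g ∘ suc))) (hasse-linear N k (f ∘ suc) a (g ∘ suc)))
    (solve 6 (λ x p a q s t → x :* (p :+ a :* q) :+ (s :+ a :* t) := x :* p :+ s :+ a :* (x :* q :+ t)) refl x _ a _ _ _)

  hasse-+ : ∀ N k f g → hasse N k (λ j → f j + g j) ≈ hasse N k f + hasse N k g
  hasse-+ N k f g = trans (hasse-cong N k (λ j → +-congˡ (sym (*-identityˡ (g j)))))
    (trans (hasse-linear N k f 1# g) (+-congˡ (*-identityˡ _)))

  -- Passing from n to n + 1 adds one coefficient, so the row for n has to be padded by a zero
  -- before the two are compared.
  hasse-suc : ∀ N k g → g N ≈ 0# → hasse (suc N) k g ≈ hasse N k g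
  hasse-suc zero    zero    g g≈0 = trans (+-cong (zeroʳ x) g≈0) (+-identityˡ 0#)
  hasse-suc zero    (suc k) g g≈0 = trans (+-congʳ (zeroʳ x)) (+-identityˡ 0#)
  hasse-suc (suc N) zero    g g≈0 = +-congʳ (*-congˡ (hasse-suc N 0 (g ∘ suc) g≈0))
  hasse-suc (suc N) (suc k) g g≈0 = +-cong (*-congˡ (hasse-suc N (suc k) (g ∘ suc) g≈0)) (hasse-suc N k (g ∘ suc) g≈0)

  -- A Hasse derivative at x is the coefficient of y^k in p(x + y), and `hasse` computes it by
  -- Horner's rule. Multiplying p by its variable multiplies p(x + y) by x + y, which is the Leibniz
  -- rule here.
  hasse-shift : ∀ N k g → hasse (suc N) k (prepend 0# g) ≈ x * hasse N k g + prepend 0# (λ k → hasse N k g) k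
  hasse-shift N zero    g = refl
  hasse-shift N (suc k) g = refl

  -- Multiplying the j-th coefficient by j × μ is the operator μ x d/dx.
  hasse-euler : ∀ N k g → hasse N k (λ j → (j × μ) * g j) ≈
                (k × μ) * hasse N k g + (suc k × μ) * x * hasse N (suc k) g

  -- Removing the constant coefficient renumbers the others by one, so the induction for
  -- `hasse-euler` meets the factor j + 1, which costs one extra multiple of μ.
  hasse-euler-suc : ∀ N k g → hasse N k (λ j → (suc j × μ) * g j) ≈
                    (k × μ) * hasse N k g + (suc k × μ) * x * hasse N (suc k) g + μ * hasse N k g
  hasse-euler-suc N k g = begin
    hasse N k (λ j → (μ + j × μ) * g j)
      ≈⟨ hasse-cong N k (λ j → trans (distribʳ _ _ _) (+-comm _ _)) ⟩
    hasse N k (λ j → (j × μ) * g j + μ * g j)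
      ≈⟨ hasse-linear N k (λ j → (j × μ) * g j) μ g ⟩
    hasse N k (λ j → (j × μ) * g j) + μ * hasse N k g
      ≈⟨ +-congʳ (hasse-euler N k g) ⟩
    (k × μ) * hasse N k g + (suc k × μ) * x * hasse N (suc k) g + μ * hasse N k g ∎

  hasse-euler zero    k       g = sym (trans (+-cong (zeroʳ _) (zeroʳ _)) (+-identityˡ 0#))
  hasse-euler (suc N) zero    g = trans (+-congʳ (*-congˡ (hasse-euler-suc N 0 (g ∘ suc))))
    (solve 5 (λ x μ h₀ h₁ g₀ →
        x :* (con 0 :* h₀ :+ (μ :+ con 0) :* x :* h₁ :+ μ :* h₀) :+ con 0 :* g₀ :=
        con 0 :* (x :* h₀ :+ g₀) :+ (μ :+ con 0) :* x :* (x :* h₁ :+ h₀))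
      refl x μ (hasse N 0 (g ∘ suc)) (hasse N 1 (g ∘ suc)) (g 0))
  hasse-euler (suc N) (suc k) g =
    trans (+-cong (*-congˡ (hasse-euler-suc N (suc k) (g ∘ suc))) (hasse-euler-suc N k (g ∘ suc)))
    (solve 6 (λ x μ κ h₀ h₁ h₂ →
        x :* ((μ :+ κ) :* h₁ :+ (μ :+ (μ :+ κ)) :* x :* h₂ :+ μ :* h₁) :+ (κ :* h₀ :+ (μ :+ κ) :* x :* h₁ :+ μ :* h₀) :=
        (μ :+ κ) :* (x :* h₁ :+ h₀) :+ (μ :+ (μ :+ κ)) :* x :* (x :* h₂ :+ h₁))
      refl x μ (k × μ) (hasse N k (g ∘ suc)) (hasse N (suc k) (g ∘ suc)) (hasse N (suc (suc k)) (g ∘ suc)))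

  horner : ∀ N g → sum {N} (λ j → g (toℕ j) * x ^ toℕ j) ≈ hasse N 0 g
  horner zero    g = refl
  horner (suc N) g = begin
    g 0 * 1# + sum {N} (λ j → g (suc (toℕ j)) * (x * x ^ toℕ j))
      ≈⟨ +-cong (*-identityʳ _) (sum-cong-≋ {N} (λ j → x∙yz≈y∙xz (g (suc (toℕ j))) x (x ^ toℕ j))) ⟩
    g 0 + sum {N} (λ j → x * (g (suc (toℕ j)) * x ^ toℕ j))
      ≈⟨ +-congˡ (*-distribˡ-sum {N} x (λ j → g (suc (toℕ j)) * x ^ toℕ j)) ⟨
    g 0 + x * sum {N} (λ j → g (suc (toℕ j)) * x ^ toℕ j)
      ≈⟨ +-congˡ (*-congˡ (horner N (g ∘ suc))) ⟩
    g 0 + x * hasse N 0 (g ∘ suc)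
      ≈⟨ +-comm _ _ ⟩
    x * hasse N 0 (g ∘ suc) + g 0 ∎
    where open Algebra.Properties.CommutativeSemigroup *-commutativeSemigroup using (x∙yz≈y∙xz)

  -- `w n` is the coefficient sequence of D(n), taken in `R` itself. With the initial row and the
  -- recurrence as the only input, `R` can be the polynomial ring with the Whitney numbers embedded
  -- as constants.
  module _ (w : ℕ → ℕ → Carrier) (w-initial : ∀ k → w 0 k ≈ S 0 k × 1#)
           (w-suc : ∀ n k → w (suc n) k ≈ prepend 0# (w n) k + (w n k + (k × μ) * w n k)) where

    w-upper : ∀ n k → n ℕ.< k → w n k ≈ 0#
    w-upper zero    (suc k) _         = w-initial (suc k)
    w-upper (suc n) (suc k) (s≤s n<k) = begin
      w (suc n) (suc k)
        ≈⟨ w-suc n (suc k) ⟩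
      w n k + (w n (suc k) + (suc k × μ) * w n (suc k))
        ≈⟨ +-cong (w-upper n k n<k) (+-cong w≈0 (trans (*-congˡ w≈0) (zeroʳ _))) ⟩
      0# + (0# + 0#)
        ≈⟨ trans (+-identityˡ _) (+-identityˡ _) ⟩
      0# ∎
      where w≈0 = w-upper n (suc k) (ℕ.m<n⇒m<1+n n<k)

    -- The recurrence of `w` says D(n+1) = x D(n) + D(n) + μ x D(n)′. The three summands are handled
    -- by `hasse-shift`, by padding, and by `hasse-euler`.
    hasse≈entry : ∀ n k → hasse (suc n) k (w n) ≈ entry n k
    hasse≈entry zero    zero    = trans (+-cong (zeroʳ x) (trans (w-initial 0) (+-identityʳ 1#))) (+-identityˡ 1#)
    hasse≈entry zero    (suc k) = trans (+-identityʳ _) (zeroʳ x)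
    hasse≈entry (suc n) k       = begin
      hasse (2 ℕ.+ n) k (w (suc n))
        ≈⟨ hasse-cong (2 ℕ.+ n) k (w-suc n) ⟩
      hasse (2 ℕ.+ n) k (λ j → prepend 0# (w n) j + (w n j + (j × μ) * w n j))
        ≈⟨ trans (hasse-+ (2 ℕ.+ n) k (prepend 0# (w n)) (λ j → w n j + (j × μ) * w n j))
                 (+-cong (hasse-shift (suc n) k (w n)) (hasse-+ (2 ℕ.+ n) k (w n) (λ j → (j × μ) * w n j))) ⟩
      x * h k + prepend 0# h k + (hasse (2 ℕ.+ n) k (w n) + hasse (2 ℕ.+ n) k (λ j → (j × μ) * w n j))
        -- D(n+1) has n + 2 coefficients. The shifted summand fills them; the other two end in a
        -- zero, because `w n (suc n)` vanishes.
        ≈⟨ +-congˡ (+-cong (hasse-suc (suc n) k (w n) w≈0)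
             (trans (hasse-suc (suc n) k (λ j → (j × μ) * w n j) (trans (*-congˡ w≈0) (zeroʳ _)))
                    (hasse-euler (suc n) k (w n)))) ⟩
      x * h k + prepend 0# h k + (h k + ((k × μ) * h k + (suc k × μ) * x * h (suc k)))
        -- Collecting the multiples of `h k` and `h (suc k)` yields `b k` and, up to reassociation,
        -- `lam (suc k)`.
        ≈⟨ solve 6 (λ x h₀ s κ λ′ h₁ → x :* h₀ :+ s :+ (h₀ :+ (κ :* h₀ :+ λ′ :* h₁)) :=
                                       s :+ ((x :+ κ :+ con 1) :* h₀ :+ λ′ :* h₁))
                   refl x (h k) (prepend 0# h k) (k × μ) ((suc k × μ) * x) (h (suc k)) ⟩
      prepend 0# h k + ((x + k × μ + 1#) * h k + (suc k × μ) * x * h (suc k))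
        ≈⟨ +-cong (shifted k) (+-cong (*-congˡ (hasse≈entry n k))
                                      (*-cong (×-assoc-* (suc k) μ x) (hasse≈entry n (suc k)))) ⟩
      entry (suc n) k ∎
      where
      h : ℕ → Carrier
      h k = hasse (suc n) k (w n)
      w≈0 = w-upper n (suc n) (ℕ.n<1+n n)
      shifted : ∀ k → prepend 0# h k ≈ prepend 0# (entry n) k
      shifted zero    = refl
      shifted (suc k) = hasse≈entry n k

    ∑≈entry : ∀ n → ∑ 0 n (λ k → w n k * x ^ k) ≈ entry n 0
    ∑≈entry n = trans (horner (suc n) (w n)) (hasse≈entry n 0)

  weight≈ : ∀ k → weight k ≈ (μ * x) ^ k * ((k !) × 1#)
  weight≈ zero    = sym (trans (*-identityˡ _) (+-identityʳ 1#))
  weight≈ (suc k) = begin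
    weight k * (suc k × (μ * x))
      ≈⟨ *-cong (weight≈ k) (trans (×-congʳ (suc k) (sym (*-identityˡ _))) (sym (×-assoc-* (suc k) 1# (μ * x)))) ⟩
    (μ * x) ^ k * ((k !) × 1#) * ((suc k × 1#) * (μ * x))
      ≈⟨ solve 4 (λ p f s y → p :* f :* (s :* y) := y :* p :* (s :* f)) refl _ _ _ _ ⟩
    (μ * x) ^ suc k * ((suc k × 1#) * ((k !) × 1#))
      ≈⟨ *-congˡ (×1-homo-* (suc k) (k !)) ⟨
    (μ * x) ^ suc k * ((suc k !) × 1#) ∎

  -- The exponent grows by n = n C 1 at each step, so Pascal's rule identifies 0 + 1 + ⋯ + (n - 1)
  -- with n C 2.
  product-powers : ∀ y n → product {n} (λ k → y ^ toℕ k) ≈ y ^ (n C 2)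
  product-powers y zero    = refl
  product-powers y (suc n) = begin
    product {suc n} (λ k → y ^ toℕ k)            ≈⟨ product-last n (y ^_) ⟩
    product {n} (λ k → y ^ toℕ k) * y ^ n        ≈⟨ *-congʳ (product-powers y n) ⟩
    y ^ (n C 2) * y ^ n                          ≈⟨ ^-homo-* y (n C 2) n ⟨
    y ^ (n C 2 ℕ.+ n)                            ≈⟨ ^-congʳ y pascal ⟩
    y ^ (suc n C 2)                              ∎
    where
    pascal : n C 2 ℕ.+ n ≡ suc n C 2
    pascal = ≡.trans (≡.cong (n C 2 ℕ.+_) (≡.sym (nC1≡n n)))
      (≡.trans (ℕ.+-comm (n C 2) (n C 1)) (nCk+nC[k+1]≡[n+1]C[k+1] n 1))

  product-weights : ∀ n → product {suc n} (weight ∘ toℕ) ≈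
                    (μ * x) ^ (suc n C 2) * product {suc n} (λ k → (toℕ k !) × 1#)
  product-weights n = begin
    product {suc n} (weight ∘ toℕ)
      ≈⟨ product-cong {suc n} (λ k → weight≈ (toℕ k)) ⟩
    product {suc n} (λ k → (μ * x) ^ toℕ k * ((toℕ k !) × 1#))
      ≈⟨ product-* {suc n} (λ k → (μ * x) ^ toℕ k) (λ k → (toℕ k !) × 1#) ⟩
    product {suc n} (λ k → (μ * x) ^ toℕ k) * product {suc n} (λ k → (toℕ k !) × 1#)
      ≈⟨ *-congʳ (product-powers (μ * x) (suc n)) ⟩
    (μ * x) ^ (suc n C 2) * product {suc n} (λ k → (toℕ k !) × 1#) ∎
    where
    open Algebra.Properties.CommutativeMonoid.Sum *-commutativeMonoid
      using () renaming (sum-cong-≋ to product-cong; ∑-distrib-+ to product-*)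

-- Specialisation to the polynomial ring over `K`

mainTheorem5 :
  ∀ {c ℓ} (K : CommutativeRing c ℓ) (m : CommutativeRing.Carrier K) →
  let open Polynomial (CommutativeRing.rawRing K)
      open RingNotation polynomialRing
      open PowerSeries polynomialRing using (_⟶_)
      open ContinuedFraction polynomialRing using (truncation)
      open Determinant polynomialRing using (hankelTransform)
      open Dowling (CommutativeRing.rawRing K) m using (D)
      b = λ (n : ℕ) → X + n × const m + 1#
      lam = λ (n : ℕ) → n × (const m * X)
  in (truncation b lam ⟶ D)
     and
     (∀ n → hankelTransform D n
            ≈ (const m * X) ^ (suc n C 2) * product {suc n} (λ k → (toℕ k !) × 1#))
mainTheorem5 K m = truncation⟶D , hankel
  where
  open PolynomialProperties K
  open Polynomial (CommutativeRing.rawRing K) using (polynomialRing; const; X)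
  open PowerSeries polynomialRing using (_⟶_)
  open ContinuedFraction polynomialRing using (truncation)
  open Determinant polynomialRing using (hankelTransform)
  open Dowling (CommutativeRing.rawRing K) m using (D; W)
  open WhitneyRecurrence K m using (W-initial; W-suc)
  open CommutativeRing polynomialCommutativeRing hiding (zero; rawRing)
  open Algebra.Properties.Semiring.Mult semiring using (_×_)
  open RingNotation polynomialRing using (_^_; product)
  open DowlingMoments polynomialCommutativeRing (const m) X
  open StieltjesMatrix polynomialCommutativeRing b lam
  open DeterminantProperties polynomialCommutativeRing using (hankelTransform-cong)
  module K = CommutativeRing K
  open Algebra.Properties.Semiring.Mult K.semiring using () renaming (_×_ to _×ᴷ_)

  const-cong : ∀ {a b} → a K.≈ b → const a ≈ const b
  const-cong a≈b zero    = a≈b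
  const-cong a≈b (suc n) = K.refl

  -- The zero polynomial is the empty list, which differs from `const 0#` as a list and equals it
  -- only coefficientwise; hence `const-0` in the base case.
  const-× : ∀ n a → const (n ×ᴷ a) ≈ n × const a
  const-× zero    a = const-0
  const-× (suc n) a = +-congˡ {const a} {const (n ×ᴷ a)} {n × const a} (const-× n a)

  w : ℕ → ℕ → Carrier
  w n k = const (W n k)

  w-initial : ∀ k → w 0 k ≈ S 0 k × 1#
  w-initial k = trans {w 0 k} {const (S 0 k ×ᴷ K.1#)} {S 0 k × 1#} (const-cong (W-initial k)) (const-× (S 0 k) K.1#)

  w-suc : ∀ n k → w (suc n) k ≈ prepend 0# (w n) k + (w n k + (k × const m) * w n k)
  w-suc n k = begin
    const (W (suc n) k)
      ≈⟨ const-cong (W-suc n k) ⟩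
    -- The sum of constants computes to the constant of the sum, so only products and natural
    -- multiples need an argument.
    const (prepend K.0# (W n) k) + (w n k + const ((k ×ᴷ m) K.* W n k))
      ≈⟨ +-cong {const (prepend K.0# (W n) k)} {prepend 0# (w n) k}
                {w n k + const ((k ×ᴷ m) K.* W n k)} {w n k + (k × const m) * w n k} (shifted k)
                (+-congˡ {w n k} {const ((k ×ᴷ m) K.* W n k)} {(k × const m) * w n k} scaled) ⟩
    prepend 0# (w n) k + (w n k + (k × const m) * w n k) ∎
    where
    open Relation.Binary.Reasoning.Setoid setoid
    shifted : ∀ k → const (prepend K.0# (W n) k) ≈ prepend 0# (w n) k
    shifted zero    = const-0
    shifted (suc k) = refl {w n k}
    scaled : const ((k ×ᴷ m) K.* W n k) ≈ (k × const m) * w n k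
    scaled = begin
      const ((k ×ᴷ m) K.* W n k)  ≈⟨ const-* (k ×ᴷ m) (W n k) ⟩
      const (k ×ᴷ m) * w n k      ≈⟨ *-congʳ {w n k} {const (k ×ᴷ m)} {k × const m} (const-× k m) ⟩
      (k × const m) * w n k       ∎

  D≈entry : ∀ n → D n ≈ entry n 0
  D≈entry = ∑≈entry w w-initial w-suc

  truncation⟶D : truncation b lam ⟶ D
  truncation⟶D k with truncation⟶moments k
  ... | N , close = N , λ n N≤n j j<k →
    trans {truncation b lam n j} {entry j 0} {D j} (close n N≤n j j<k) (sym {D j} {entry j 0} (D≈entry j))

  hankel : ∀ n → hankelTransform D n ≈ (const m * X) ^ (suc n C 2) * product {suc n} (λ k → (toℕ k !) × 1#)
  hankel n = begin
    hankelTransform D n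
      ≈⟨ hankelTransform-cong D (λ i → entry i 0) D≈entry n ⟩
    hankelTransform (λ i → entry i 0) n
      ≈⟨ hankelTransform-moments n ⟩
    product {suc n} (λ k → weight (toℕ k))
      ≈⟨ product-weights n ⟩
    (const m * X) ^ (suc n C 2) * product {suc n} (λ k → (toℕ k !) × 1#) ∎
    where open Relation.Binary.Reasoning.Setoid setoid
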